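{- For every $n\ge 1$ there is a bijection $\Psi_n$ from the set of PDSAWs in the asymmetric wedge (that is, staying below the $x$-axis) with $n$ east steps to the set of permutations of $[n]=\{1,\dots,n\}$ such that, for every such PDSAW $P$ and all integers $N$, $M$, the path $P$ has - exactly $N$ north steps and - last descent of length $M$ if and only if the permutation $\sigma=\Psi_n(P)$ has - exactly $N$ nestings and - $\sigma(1)=M$. Moreover, the bijections $\Psi_n$ ($n\ge 1$) can be chosen so that factors are preserved with their order reversed (in particular the last factor of the PDSAW is mapped to the first factor of the permutation): if $P_1,P_2,\dots,P_r$ are the consecutive prime factors of $P$, with $P_i$ having $n_i$ east steps, then the consecutive prime factors of the permutation $\Psi_n(P)$, from left to right, are $\Psi_{n_r}(P_r),\Psi_{n_{r-1}}(P_{r-1}),\dots,\Psi_{n_1}(P_1)$ (where each $P_i$ is translated so as to start at the origin, and each factor of the permutation is relabelled order-preservingly to a permutation of an initial interval $[n_i]$).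
   Context: A partially directed self avoiding walk (PDSAW) is a walk in the plane starting at the origin and taking unit east, north and south steps, where a north step is never immediately followed or preceded by a south step. A PDSAW in the asymmetric wedge is a PDSAW that stays within the (closed) wedge $\{(x,y): -x\le y\le 0\}$ and ends at some point of the line $y=-x$; with $n$ east steps it therefore ends at $(n,-n)$. Such a walk is determined by the $y$-coordinates of its east steps. The length of the last descent is the number of south steps after the last east step. For a permutation $\sigma$ of $[n]$, the arc $(i,\sigma(i))$ is nested by the arc $(j,\sigma(j))$ if $j<i\le\sigma(i)<\sigma(j)$ or $j>i>\sigma(i)>\sigma(j)$. The number of nestings of $\sigma$ is the number of pairs $(i,j)$ such that $(i,\sigma(i))$ is nested by $(j,\sigma(j))$. A factor of a PDSAW in the asymmetric wedge is a sub-path starting at $(a,-a)$ and ending at $(b,-b)$, for some $a<b$, such that all east steps of the PDSAW after the point $(a,-a)$ are (weakly) below the line $y=-a$, and all east steps of the PDSAW after the point $(b,-b)$ are (weakly) below the line $y=-b$. A factor of a permutation is a sub-permutation on an interval $\{a,a+1,\dots,b\}$ such that all elements less than $a$ are mapped to elements less than $a$, and all elements greater than $b$ are mapped to elements greater than $b$. A factor is prime if it contains no smaller factor. Every PDSAW in the asymmetric wedge, and every permutation, is the concatenation of its consecutive prime factors; the last factor of a PDSAW is its last prime factor and the first factor of a permutation is its first (leftmost) prime factor. -}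

module Defs where

open import Data.Fin.Base as Fin using (Fin; zero; toℕ)
open import Data.Fin.Permutation using (Permutation′; _⟨$⟩ʳ_)
import Data.Fin.Properties as Fin
open import Data.Integer.Base as ℤ using (ℤ; +_; -_; 0ℤ; 1ℤ)
open import Data.List.Base
  using (List; []; _∷_; _++_; length; filter; foldl; allFin; cartesianProduct)
open import Data.List.Relation.Unary.All using (All)
open import Data.List.Relation.Unary.Linked using (Linked)
open import Data.List.Scans.Base using (scanl)
open import Data.Nat.Base using (ℕ; suc; _+_; _≤_; _<_)
open import Data.Product.Base using (_×_; _,_; ∃; ∃-syntax)
open import Data.Sum.Base using (_⊎_)
open import Level using (0ℓ)
open import Relation.Binary.Bundles using (Setoid)
import Relation.Binary.Construct.On as On
open import Relation.Binary.Definitions using (DecidableEquality)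
open import Relation.Binary.PropositionalEquality
  using (_≡_; refl; setoid; _→-setoid_)
open import Relation.Nullary using (¬_; Dec; yes; no)
open import Relation.Nullary.Decidable using (_×-dec_; _⊎-dec_)

------------------------------------------------------------------------
-- Walks

data Step : Set where
  east north south : Step

infix 4 _≟_

_≟_ : DecidableEquality Step
east  ≟ east  = yes refl
east  ≟ north = no λ ()
east  ≟ south = no λ ()
north ≟ east  = no λ ()
north ≟ north = yes refl
north ≟ south = no λ ()
south ≟ east  = no λ ()
south ≟ north = no λ ()
south ≟ south = yes refl

-- No walk below ever has a negative abscissa, so abscissas are naturals.
Point : Set
Point = ℕ × ℤ

origin : Point
origin = 0 , 0ℤ

move : Point → Step → Point
move (x , y) east  = suc x , y
move (x , y) north = x , y ℤ.+ 1ℤ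
move (x , y) south = x , y ℤ.- 1ℤ

end : List Step → Point
end = foldl move origin

-- The point (a , -a).
diagonal : ℕ → Point
diagonal a = a , - (+ a)

-- The wedge is convex, so a walk stays in it as soon as its vertices do.
InWedge : Point → Set
InWedge (x , y) = (- (+ x) ℤ.≤ y) × (y ℤ.≤ 0ℤ)

OnDiagonal : Point → Set
OnDiagonal (x , y) = y ≡ - (+ x)

data Opposite : Step → Step → Set where
  north-south : Opposite north south
  south-north : Opposite south north

#[_] : Step → List Step → ℕ
#[ s ] w = length (filter (s ≟_) w)

record PDSAW (n : ℕ) : Set where
  field
    steps             : List Step
    partiallyDirected : Linked (λ s t → ¬ Opposite s t) steps
    staysInWedge      : All InWedge (scanl move origin steps)
    endsOnDiagonal    : OnDiagonal (end steps)
    eastSteps         : #[ east ] steps ≡ n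

open PDSAW public using (steps)

-- Walks are equal when their step sequences are.
PDSAWs : ℕ → Setoid 0ℓ 0ℓ
PDSAWs n = On.setoid (setoid (List Step)) (steps {n})

northSteps : ∀ {n} → PDSAW n → ℕ
northSteps P = #[ north ] (steps P)

-- One step of a running count of the south steps since the last east step.
southsSinceEast : ℕ → Step → ℕ
southsSinceEast k east  = 0
southsSinceEast k north = k
southsSinceEast k south = suc k

lastDescent : ∀ {n} → PDSAW n → ℕ
lastDescent P = foldl southsSinceEast 0 (steps P)

------------------------------------------------------------------------
-- Permutations of {1,…,n}, the element i being represented by i - 1 : Fin n

Permutations : ℕ → Setoid 0ℓ 0ℓ
Permutations n = On.setoid (Fin n →-setoid Fin n) (_⟨$⟩ʳ_ {n} {n})

-- The arc (i , σ i) is nested by the arc (j , σ j).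
Nested : ∀ {n} → Permutation′ n → Fin n × Fin n → Set
Nested σ (i , j) =
    (j Fin.< i × i Fin.≤ σ ⟨$⟩ʳ i × σ ⟨$⟩ʳ i Fin.< σ ⟨$⟩ʳ j)
  ⊎ (i Fin.< j × σ ⟨$⟩ʳ i Fin.< i × σ ⟨$⟩ʳ j Fin.< σ ⟨$⟩ʳ i)

nested? : ∀ {n} (σ : Permutation′ n) ij → Dec (Nested σ ij)
nested? σ (i , j) =
    (j Fin.<? i ×-dec i Fin.≤? σ ⟨$⟩ʳ i ×-dec σ ⟨$⟩ʳ i Fin.<? σ ⟨$⟩ʳ j)
  ⊎-dec
    (i Fin.<? j ×-dec σ ⟨$⟩ʳ i Fin.<? i ×-dec σ ⟨$⟩ʳ j Fin.<? σ ⟨$⟩ʳ i)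

nestings : ∀ {n} → Permutation′ n → ℕ
nestings {n} σ =
  length (filter (nested? σ) (cartesianProduct (allFin n) (allFin n)))

-- σ(1) as an element of {1,…,n}.
firstValue : ∀ {m} → Permutation′ (suc m) → ℕ
firstValue σ = suc (toℕ (σ ⟨$⟩ʳ zero))

------------------------------------------------------------------------
-- Prime factors

-- The interval from a′ to b′ is strictly smaller than that from a to b.
StrictlyWithin : (a′ b′ a b : ℕ) → Set
StrictlyWithin a′ b′ a b = a ≤ a′ × b′ ≤ b × (a < a′ ⊎ b′ < b)

-- The ordinates of the east steps of a walk started at the given point.
eastHeights : Point → List Step → List ℤ
eastHeights p       []          = []
eastHeights (x , y) (east  ∷ w) = y ∷ eastHeights (move (x , y) east) w
eastHeights p       (north ∷ w) = eastHeights (move p north) w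
eastHeights p       (south ∷ w) = eastHeights (move p south) w

-- f is the sub-path of w from (a , -a) to (b , -b), and it is a factor.
-- Paths being step sequences, f is already translated to the origin.
record WalkFactor (w : List Step) (a b : ℕ) (f : List Step) : Set where
  field
    before after : List Step
    subPath      : w ≡ before ++ f ++ after
    starts       : end before ≡ diagonal a
    ends         : end (before ++ f) ≡ diagonal b
    a<b          : a < b
    belowStart   : All (ℤ._≤ - (+ a)) (eastHeights (diagonal a) (f ++ after))
    belowEnd     : All (ℤ._≤ - (+ b)) (eastHeights (diagonal b) after)

PrimeWalkFactor : List Step → ℕ → ℕ → List Step → Set
PrimeWalkFactor w a b f =
    WalkFactor w a b f
  × ¬ (∃[ a′ ] ∃[ b′ ] ∃[ f′ ] WalkFactor w a′ b′ f′ × StrictlyWithin a′ b′ a b)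

-- Walks and permutations of arbitrary positive size; (m , _) has size suc m.
PDSAW⁺ Permutation⁺ : Set
PDSAW⁺       = ∃ λ m → PDSAW (suc m)
Permutation⁺ = ∃ λ m → Permutation′ (suc m)

-- The consecutive prime factors of a walk from (a , -a) to (n , -n), where
-- n is the number of east steps of the walk.
data WalkPrimesFrom {n} (P : PDSAW n) : ℕ → List PDSAW⁺ → Set where
  []  : WalkPrimesFrom P n []
  _∷_ : ∀ {a m} {Q : PDSAW (suc m)} {Qs} →
        PrimeWalkFactor (steps P) a (a + suc m) (steps Q) →
        WalkPrimesFrom P (a + suc m) Qs →
        WalkPrimesFrom P a ((m , Q) ∷ Qs)

WalkPrimes : ∀ {n} → PDSAW n → List PDSAW⁺ → Set
WalkPrimes P = WalkPrimesFrom P 0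

-- σ has a factor on the interval {a,…,b}.
record PermFactor {n} (σ : Permutation′ n) (a b : Fin n) : Set where
  field
    a≤b    : a Fin.≤ b
    within : ∀ i → a Fin.≤ i → i Fin.≤ b →
             a Fin.≤ σ ⟨$⟩ʳ i × σ ⟨$⟩ʳ i Fin.≤ b
    below  : ∀ i → i Fin.< a → σ ⟨$⟩ʳ i Fin.< a
    above  : ∀ i → b Fin.< i → b Fin.< σ ⟨$⟩ʳ i

PrimePermFactor : ∀ {n} → Permutation′ n → Fin n → Fin n → Set
PrimePermFactor σ a b =
    PermFactor σ a b
  × ¬ (∃[ a′ ] ∃[ b′ ] PermFactor σ a′ b′
                     × StrictlyWithin (toℕ a′) (toℕ b′) (toℕ a) (toℕ b))

-- The restriction of σ to the size-k interval starting at a, relabelled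
-- order-preservingly, is τ.
RestrictsTo : ∀ {n k} → Permutation′ n → Fin n → Permutation′ k → Set
RestrictsTo σ a τ = ∀ i j → toℕ i ≡ toℕ a + toℕ j →
                    toℕ (σ ⟨$⟩ʳ i) ≡ toℕ a + toℕ (τ ⟨$⟩ʳ j)

-- The consecutive prime factors, left to right, of σ on the elements of
-- Fin n from position p on.
data PermPrimesFrom {n} (σ : Permutation′ n) : ℕ → List Permutation⁺ → Set where
  []   : PermPrimesFrom σ n []
  cons : ∀ {p m} {τ : Permutation′ (suc m)} {τs} (a b : Fin n) →
         toℕ a ≡ p →
         toℕ b ≡ p + m →
         PrimePermFactor σ a b →
         RestrictsTo σ a τ →
         PermPrimesFrom σ (p + suc m) τs →
         PermPrimesFrom σ p ((m , τ) ∷ τs)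

PermPrimes : ∀ {n} → Permutation′ n → List Permutation⁺ → Set
PermPrimes σ = PermPrimesFrom σ 0

module Submission where

-- Record an east step of a walk by the elevation of its starting point above the line y = -x,
-- and list the steps backwards as p ∷ ps, the last one first.  The only constraint is p ≤ length ps;
-- the last descent is p + 1, and with ps = q ∷ qs the step contributes p ∸ (q + 1) north steps.
--
-- A permutation σ is encoded, as by Foata and Zeilberger, by one letter for each value x: whether
-- x ≤ σ(x), whether σ⁻¹(x) ≤ x, and the number of arcs nesting (σ⁻¹(x), x).  The words obtained
-- are exactly the labelled Motzkin paths called histories, and the factors of σ sit between the
-- returns of the path to height 0.  The value σ(1) is the first x with σ⁻¹(x) ≤ x and label 0.
--
-- An east step p acts on histories by inserting a letter at place p so that the new first such x
-- is at p.  If the old one is at q < p, its letter no longer closes an arc, and the labels of the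
-- p ∸ (q + 1) letters in between grow by 1: new nestings match new north steps.  The insertion
-- ignores whatever follows place p, so a walk that starts anew at a diagonal point
-- gives a concatenation of histories, in reversed order.  Every history is an insertion in a
-- smaller one, and a permutation is determined by its history, so bijectivity follows by counting.

open import Defs
open import Data.Bool.Base using (Bool; true; false; not)
open import Data.Fin.Base as Fin using (Fin; zero; suc; toℕ; fromℕ<; punchOut)
open import Data.Fin.Permutation as Permutation
  using (Permutation′; _⟨$⟩ʳ_; _⟨$⟩ˡ_; inverseˡ; inverseʳ; insert-punchIn)
import Data.Fin.Properties as Fin
open import Data.Integer.Base as ℤ using (ℤ; +_; -_; _⊖_; 1ℤ)
import Data.Integer.Properties as ℤ
open import Data.List.Base
  using (List; []; _∷_; _++_; length; map; filter; foldl; tabulate; replicate;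
         reverse; _ʳ++_; cartesianProduct)
open import Data.List.Properties
  using (∷-injective; filter-++; length-++; foldl-++; length-reverse; reverse-involutive;
         reverse-injective; reverse-++; ++-assoc; ++-identityʳ)
open import Data.List.Relation.Unary.All using (All; []; _∷_)
open import Data.List.Relation.Unary.Linked as Linked using (Linked; []; [-]; _∷_)
open import Data.List.Scans.Base using (scanl)
open import Data.Nat.Base using (ℕ; zero; suc; _+_; _∸_; _≤_; _<_; z≤n; s≤s; _!)
open import Data.Nat.Properties renaming (_≟_ to _≟ℕ_)
open import Data.Product.Base using (_×_; _,_; ∃-syntax; Σ-syntax; proj₁; proj₂)
open import Data.Product.Function.NonDependent.Propositional using (_×-↔_)
open import Data.Product.Properties using (,-injective)
open import Data.Sum.Base as Sum using (_⊎_; inj₁; inj₂)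
open import Data.Unit.Base using (⊤; tt)
open import Function.Base using (_∘_)
open import Function.Bundles using (Bijection; Injection; Inverse; _↔_; _⇔_; mk↔ₛ′; mk⇔)
open import Function.Definitions using (Injective)
open import Function.Properties.Inverse using (↔-refl; ↔-sym; ↔-trans; ↔⇒↣)
open import Relation.Binary.Definitions using (tri<; tri≈; tri>)
open import Relation.Binary.PropositionalEquality
open import Relation.Nullary using (¬_; Dec; yes; no; does; contradiction)
open import Relation.Nullary.Decidable using (_×-dec_; _⊎-dec_; dec-true; dec-false)
open import Relation.Unary using (Decidable)

open import Algebra.Properties.CommutativeMonoid.Sum +-0-commutativeMonoid
  using (sum; sum-permute; sum-cong-≗)
open import Algebra.Properties.CommutativeSemigroup +-commutativeSemigroup using (interchange)
open Inverse using (to; from; strictlyInverseˡ; strictlyInverseʳ)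

-- Histories

record Letter : Set where
  constructor ⟨_,_,_⟩
  field
    opens closes : Bool
    label        : ℕ

open Letter

bit : Bool → ℕ
bit false = 0
bit true  = 1

-- The letters are the steps of a Motzkin path: up when a letter only opens, down when it only
-- closes, level otherwise. An opening letter has a label at most the height `h`, any other letter a
-- label below `h`. There are `n !` such words of length `n` from height 0 to height 0 (Laguerre
-- histories).
data History : ℕ → List Letter → ℕ → Set where
  []   : ∀ {h} → History h [] h
  step : ∀ {h h′ k o c r w} → r + bit (not o) ≤ h → h + bit o ≡ h′ + bit c →
         History h′ w k → History h (⟨ o , c , r ⟩ ∷ w) k

History-functional : ∀ {h k k′ w} → History h w k → History h w k′ → k ≡ k′
History-functional [] [] = refl
History-functional (step {c = c} _ e H) (step _ e′ H′)
  with refl ← +-cancelʳ-≡ (bit c) _ _ (trans (sym e) e′) = History-functional H H′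

-- Insertion of a letter

raise : ℕ → List Letter → List Letter
raise zero    w                     = ⟨ false , true , 0 ⟩ ∷ w
raise (suc p) []                    = []
raise (suc p) (⟨ o , c , r ⟩ ∷ w) = ⟨ o , c , suc r ⟩ ∷ raise p w

-- Making the first closing letter with label 0 non-closing lifts the path by one level. `raise`
-- follows the lifted part, where larger labels are allowed, and its new closing letter at place `p`
-- brings the path back. If no such letter is met before `p`, a level step is put there instead. The
-- clauses for `[]` are defaults outside the range `p ≤ length w`.
insert : ℕ → List Letter → List Letter
insert zero    w                           = ⟨ true , true , 0 ⟩ ∷ w
insert (suc p) []                          = []
insert (suc p) (⟨ o , true  , zero  ⟩ ∷ w) = ⟨ o , false , 0 ⟩ ∷ raise p w
insert (suc p) (⟨ o , true  , suc r ⟩ ∷ w) = ⟨ o , true , suc r ⟩ ∷ insert p w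
insert (suc p) (⟨ o , false , r     ⟩ ∷ w) = ⟨ o , false , r ⟩ ∷ insert p w

firstZero : List Letter → ℕ
firstZero []                          = 0
firstZero (⟨ o , true  , zero  ⟩ ∷ w) = 0
firstZero (⟨ o , true  , suc r ⟩ ∷ w) = suc (firstZero w)
firstZero (⟨ o , false , r     ⟩ ∷ w) = suc (firstZero w)

total : List Letter → ℕ
total []      = 0
total (l ∷ w) = label l + total w

length-raise : ∀ {p w} → p ≤ length w → length (raise p w) ≡ suc (length w)
length-raise {zero}          _       = refl
length-raise {suc p} {_ ∷ w} (s≤s p≤) = cong suc (length-raise p≤)

length-insert : ∀ {p w} → p ≤ length w → length (insert p w) ≡ suc (length w)
length-insert {zero}                                 _        = refl
length-insert {suc p} {⟨ _ , true , zero ⟩ ∷ w}  (s≤s p≤) = cong suc (length-raise p≤)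
length-insert {suc p} {⟨ _ , true , suc _ ⟩ ∷ w} (s≤s p≤) = cong suc (length-insert p≤)
length-insert {suc p} {⟨ _ , false , _ ⟩ ∷ w}    (s≤s p≤) = cong suc (length-insert p≤)

raise-++ : ∀ {p w} v → p ≤ length w → raise p (w ++ v) ≡ raise p w ++ v
raise-++ {zero}          v _        = refl
raise-++ {suc p} {_ ∷ w} v (s≤s p≤) = cong (_ ∷_) (raise-++ v p≤)

insert-++ : ∀ {p w} v → p ≤ length w → insert p (w ++ v) ≡ insert p w ++ v
insert-++ {zero}                               v _        = refl
insert-++ {suc p} {⟨ _ , true , zero ⟩ ∷ w}  v (s≤s p≤) = cong (_ ∷_) (raise-++ v p≤)
insert-++ {suc p} {⟨ _ , true , suc _ ⟩ ∷ w} v (s≤s p≤) = cong (_ ∷_) (insert-++ v p≤)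
insert-++ {suc p} {⟨ _ , false , _ ⟩ ∷ w}    v (s≤s p≤) = cong (_ ∷_) (insert-++ v p≤)

-- All labels passed on the way become positive, so the added letter is the first closing one with
-- label 0.
firstZero-raise : ∀ {p w} → p ≤ length w → firstZero (raise p w) ≡ p
firstZero-raise {zero}                           _        = refl
firstZero-raise {suc p} {⟨ _ , true , _ ⟩ ∷ w}  (s≤s p≤) = cong suc (firstZero-raise p≤)
firstZero-raise {suc p} {⟨ _ , false , _ ⟩ ∷ w} (s≤s p≤) = cong suc (firstZero-raise p≤)

firstZero-insert : ∀ {p w} → p ≤ length w → firstZero (insert p w) ≡ p
firstZero-insert {zero}                               _        = refl
firstZero-insert {suc p} {⟨ _ , true , zero ⟩ ∷ w}  (s≤s p≤) = cong suc (firstZero-raise p≤)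
firstZero-insert {suc p} {⟨ _ , true , suc _ ⟩ ∷ w} (s≤s p≤) = cong suc (firstZero-insert p≤)
firstZero-insert {suc p} {⟨ _ , false , _ ⟩ ∷ w}    (s≤s p≤) = cong suc (firstZero-insert p≤)

total-raise : ∀ {p w} → p ≤ length w → total (raise p w) ≡ total w + p
total-raise {zero}                          _        = sym (+-identityʳ _)
total-raise {suc p} {⟨ _ , _ , r ⟩ ∷ w} (s≤s p≤) = begin
  suc (r + total (raise p w))  ≡⟨ cong (λ t → suc (r + t)) (total-raise p≤) ⟩
  suc (r + (total w + p))      ≡⟨ cong suc (+-assoc r _ p) ⟨
  suc (r + total w + p)        ≡⟨ +-suc _ p ⟨
  r + total w + suc p          ∎
  where open ≡-Reasoning

-- If the old first zero `q` lies below `p`, exactly the `p ∸ suc q` letters in between are raised.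
-- Otherwise nothing is raised, and truncated subtraction gives 0.
total-insert : ∀ {p w} → p ≤ length w →
               total (insert p w) ≡ total w + (p ∸ suc (firstZero w))
total-insert {zero} _ = sym (+-identityʳ _)
total-insert {suc p} {⟨ _ , true , zero ⟩ ∷ w} (s≤s p≤) = total-raise p≤
total-insert {suc p} {⟨ _ , true , suc r ⟩ ∷ w} (s≤s p≤) =
  trans (cong (_+_ (suc r)) (total-insert p≤)) (sym (+-assoc (suc r) _ _))
total-insert {suc p} {⟨ _ , false , r ⟩ ∷ w} (s≤s p≤) =
  trans (cong (_+_ r) (total-insert p≤)) (sym (+-assoc r _ _))

private
  -- Only a closing letter with label 0 can lead to height 0. Hence, as long as `uninsert` has not
  -- met one, there is more of the word to read.
  0<next : ∀ {h h′ o c r} → r + bit (not o) ≤ h → h + bit o ≡ h′ + bit c →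
        c ≡ false ⊎ 0 < r → 0 < h′
  0<next {h} {h′} {true} {false} {r} _ e _ =
    subst (0 <_) (trans e (+-identityʳ h′)) (m≤n⇒m≤o+n h ≤-refl)
  0<next {h} {h′} {false} {false} {r} b e _ =
    ≤-trans (m≤n+m 1 r) (≤-trans b (≤-reflexive (trans (sym (+-identityʳ h)) (trans e (+-identityʳ h′)))))
  0<next {h} {h′} {true} {true} {r} b e (inj₂ 0<r) =
    subst (0 <_) (+-cancelʳ-≡ 1 h h′ e) (≤-trans 0<r (≤-trans (m≤m+n r 0) b))
  0<next {h} {h′} {false} {true} {r} b e (inj₂ 0<r) =
    ≤-trans 0<r (+-cancelʳ-≤ 1 r h′ (≤-trans b (≤-reflexive (trans (sym (+-identityʳ h)) e))))

-- Reading a history backwards: Raised is the state before the letter that an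
-- insertion turned from closing to non-closing has been met.
Inserted Raised : ℕ → List Letter → Set
Inserted h w = ∃[ p ] ∃[ v ] p ≤ length v × w ≡ insert p v × History h v 0
Raised   h w = ∃[ p ] ∃[ v ] ∃[ h′ ]
               p ≤ length v × w ≡ raise p v × h ≡ suc h′ × History h′ v 0

-- The recursion descends to the first closing letter with label 0, the one that was put in last,
-- and undoes the insertion on its way back. If that letter is a down step, labels are lowered until
-- a non-closing letter with label 0 appears: it cannot have been raised, so it is the letter to be
-- made closing again.
uninsert : ∀ {h w} → History h w 0 → 0 < h ⊎ 0 < length w → Inserted h w ⊎ Raised h w
uninsert [] (inj₁ ())
uninsert [] (inj₂ ())
uninsert {h} (step {h′ = h′} {o = true} {true} {zero} {w} b e H) _ =
  inj₁ (0 , w , z≤n , refl , subst (λ k → History k w 0) (sym (+-cancelʳ-≡ 1 h h′ e)) H)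
uninsert {h} (step {h′ = h′} {o = false} {true} {zero} {w} b e H) _ =
  inj₂ (0 , w , h′ , z≤n , refl , trans (trans (sym (+-identityʳ h)) e) (+-comm h′ 1) , H)
uninsert (step {o = o} {true} {suc r} b e H) _ with uninsert H (inj₁ (0<next {o = o} b e (inj₂ (s≤s z≤n))))
... | inj₁ (p , v , p≤ , refl , H′) =
  inj₁ (suc p , ⟨ o , true , suc r ⟩ ∷ v , s≤s p≤ , refl , step b e H′)
... | inj₂ (p , v , h′ , p≤ , refl , refl , H′) with s≤s b′ ← b =
  inj₂ (suc p , ⟨ o , true , r ⟩ ∷ v , _ , s≤s p≤ , refl , refl , step b′ (suc-injective e) H′)
uninsert (step {o = o} {false} {zero} b e H) _ with uninsert H (inj₁ (0<next {o = o} b e (inj₁ refl)))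
... | inj₁ (p , v , p≤ , refl , H′) =
  inj₁ (suc p , ⟨ o , false , 0 ⟩ ∷ v , s≤s p≤ , refl , step b e H′)
... | inj₂ (p , v , h′ , p≤ , refl , refl , H′) =
  inj₁ (suc p , ⟨ o , true , 0 ⟩ ∷ v , s≤s p≤ , refl , step b (trans e (sym (+-suc h′ 0))) H′)
uninsert (step {o = o} {false} {suc r} b e H) _ with uninsert H (inj₁ (0<next {o = o} b e (inj₁ refl)))
... | inj₁ (p , v , p≤ , refl , H′) =
  inj₁ (suc p , ⟨ o , false , suc r ⟩ ∷ v , s≤s p≤ , refl , step b e H′)
... | inj₂ (p , v , h′ , p≤ , refl , refl , H′) with s≤s b′ ← b =
  inj₂ (suc p , ⟨ o , false , r ⟩ ∷ v , _ , s≤s p≤ , refl , refl , step b′ (suc-injective e) H′)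

-- Words built by successive insertions

data Bounded : List ℕ → Set where
  []  : Bounded []
  _∷_ : ∀ {p ps} → p ≤ length ps → Bounded ps → Bounded (p ∷ ps)

build : List ℕ → List Letter
build []       = []
build (p ∷ ps) = insert p (build ps)

length-build : ∀ {ps} → Bounded ps → length (build ps) ≡ length ps
length-build []       = refl
length-build (p≤ ∷ B) =
  trans (length-insert (≤-trans p≤ (≤-reflexive (sym (length-build B))))) (cong suc (length-build B))

≤-build : ∀ {p ps} → p ≤ length ps → Bounded ps → p ≤ length (build ps)
≤-build p≤ B = ≤-trans p≤ (≤-reflexive (sym (length-build B)))

-- The places in `ps` stay within the letters inserted for `ps`, so `build qs`, which is formed
-- first, is never touched.
build-++ : ∀ {ps} qs → Bounded ps → build (ps ++ qs) ≡ build ps ++ build qs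
build-++ qs []       = refl
build-++ qs (p≤ ∷ B) =
  trans (cong (insert _) (build-++ qs B)) (insert-++ (build qs) (≤-build p≤ B))

-- This is the direction obtained by undoing insertions; that `build` is injective and yields
-- histories follows later by counting.
build-surjective : ∀ n {w} → length w ≡ n → History 0 w 0 →
                   ∃[ ps ] Bounded ps × length ps ≡ n × build ps ≡ w
build-surjective zero    {[]} refl H = [] , [] , refl , refl
build-surjective (suc n) {w}  eq   H with uninsert H (inj₂ (subst (0 <_) (sym eq) (s≤s z≤n)))
-- A path that starts at height 0 cannot be `Raised`.
... | inj₁ (p , v , p≤ , refl , H′)
  with build-surjective n (suc-injective (trans (sym (length-insert p≤)) eq)) H′
...   | ps , B , len , refl =
  p ∷ ps , ≤-trans p≤ (≤-reflexive (length-build B)) ∷ B , cong suc len , refl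

jumps : List ℕ → ℕ
jumps []           = 0
jumps (p ∷ [])     = 0
jumps (p ∷ q ∷ ps) = jumps (q ∷ ps) + (p ∸ suc q)

total-build : ∀ {ps} → Bounded ps → total (build ps) ≡ jumps ps
total-build []             = refl
total-build (z≤n ∷ [])     = refl
total-build {p ∷ q ∷ ps} (p≤ ∷ q≤ ∷ B) = begin
  total (insert p w)              ≡⟨ total-insert (≤-build p≤ (q≤ ∷ B)) ⟩
  total w + (p ∸ suc (firstZero w)) ≡⟨ cong₂ (λ t f → t + (p ∸ suc f)) (total-build (q≤ ∷ B))
                                        (firstZero-insert (≤-build q≤ B)) ⟩
  jumps (q ∷ ps) + (p ∸ suc q)    ∎
  where open ≡-Reasoning
        w = build (q ∷ ps)

-- The history of a permutation

∑ : ℕ → (ℕ → ℕ) → ℕ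
∑ zero    f = 0
∑ (suc n) f = f 0 + ∑ n (f ∘ suc)

∑-cong : ∀ n {f g} → (∀ {i} → i < n → f i ≡ g i) → ∑ n f ≡ ∑ n g
∑-cong zero    eq = refl
∑-cong (suc n) eq = cong₂ _+_ (eq (s≤s z≤n)) (∑-cong n (eq ∘ s≤s))

∑-mono : ∀ n {f g} → (∀ {i} → i < n → f i ≤ g i) → ∑ n f ≤ ∑ n g
∑-mono zero    le = z≤n
∑-mono (suc n) le = +-mono-≤ (le (s≤s z≤n)) (∑-mono n (le ∘ s≤s))

∑-mono-< : ∀ n {f g k} → (∀ {i} → i < n → f i ≤ g i) → k < n → f k < g k → ∑ n f < ∑ n g
∑-mono-< (suc n) {k = zero}  le _         lt = +-mono-<-≤ lt (∑-mono n (le ∘ s≤s))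
∑-mono-< (suc n) {k = suc k} le (s≤s k<n) lt =
  +-mono-≤-< (le (s≤s z≤n)) (∑-mono-< n (le ∘ s≤s) k<n lt)

∑-zero : ∀ n {f} → (∀ {i} → i < n → f i ≡ 0) → ∑ n f ≡ 0
∑-zero zero    eq = refl
∑-zero (suc n) eq = cong₂ _+_ (eq (s≤s z≤n)) (∑-zero n (eq ∘ s≤s))

term≤∑ : ∀ n {f k} → k < n → f k ≤ ∑ n f
term≤∑ (suc n) {k = zero}  _         = m≤m+n _ _
term≤∑ (suc n) {k = suc k} (s≤s k<n) = ≤-trans (term≤∑ n k<n) (m≤n+m _ _)

∑-distrib-+ : ∀ n f g → ∑ n (λ i → f i + g i) ≡ ∑ n f + ∑ n g
∑-distrib-+ zero    f g = refl
∑-distrib-+ (suc n) f g = trans (cong (_+_ (f 0 + g 0)) (∑-distrib-+ n (f ∘ suc) (g ∘ suc)))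
                                (interchange (f 0) (g 0) _ _)

∑-split : ∀ m n f → ∑ (m + n) f ≡ ∑ m f + ∑ n (λ i → f (m + i))
∑-split zero    n f = refl
∑-split (suc m) n f = trans (cong (_+_ (f 0)) (∑-split m n (f ∘ suc))) (sym (+-assoc (f 0) _ _))

∑-single : ∀ n {f k} → k < n → (∀ {i} → i < n → i ≢ k → f i ≡ 0) → ∑ n f ≡ f k
∑-single (suc n) {f} {zero} _ off =
  trans (cong (_+_ (f 0)) (∑-zero n λ i<n → off (s≤s i<n) λ ())) (+-identityʳ _)
∑-single (suc n) {f} {suc k} (s≤s k<n) off =
  trans (cong (_+ ∑ n (f ∘ suc)) (off (s≤s z≤n) λ ()))
        (∑-single n k<n λ i<n i≢k → off (s≤s i<n) (i≢k ∘ suc-injective))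

𝟙 : ∀ {P : Set} → Dec P → ℕ
𝟙 P? = bit (does P?)

module _ {P : Set} where

  𝟙-yes : (P? : Dec P) → P → 𝟙 P? ≡ 1
  𝟙-yes P? p = cong bit (dec-true P? p)

  𝟙-no : (P? : Dec P) → ¬ P → 𝟙 P? ≡ 0
  𝟙-no P? ¬p = cong bit (dec-false P? ¬p)

  𝟙-zero : (P? : Dec P) → 𝟙 P? ≡ 0 → ¬ P
  𝟙-zero (no ¬p) _ = ¬p

module _ {P Q : Set} where

  𝟙-mono : (P? : Dec P) (Q? : Dec Q) → (P → Q) → 𝟙 P? ≤ 𝟙 Q?
  𝟙-mono (no _)  Q? _ = z≤n
  𝟙-mono (yes p) Q? f = ≤-reflexive (sym (𝟙-yes Q? (f p)))

  𝟙-< : (P? : Dec P) (Q? : Dec Q) → ¬ P → Q → 𝟙 P? < 𝟙 Q?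
  𝟙-< P? Q? ¬p q = subst₂ _<_ (sym (𝟙-no P? ¬p)) (sym (𝟙-yes Q? q)) (s≤s z≤n)

  does-cong : (P? : Dec P) (Q? : Dec Q) → (P → Q) → (Q → P) → does P? ≡ does Q?
  does-cong P? (yes q) f g = dec-true P? (g q)
  does-cong P? (no ¬q) f g = dec-false P? (¬q ∘ f)

  does-transport : (P? : Dec P) (Q? : Dec Q) → does P? ≡ does Q? → P → Q
  does-transport (no ¬p) _       _ p = contradiction p ¬p
  does-transport (yes _) (yes q) _ _ = q

  𝟙-+ : ∀ {R : Set} (P? : Dec P) (Q? : Dec Q) (R? : Dec R) →
        (R → P ⊎ Q) → (P → R) → (Q → R) → ¬ (P × Q) → 𝟙 P? + 𝟙 Q? ≡ 𝟙 R?
  𝟙-+ (yes p) (yes q) R? _ _ _ d = contradiction (p , q) d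
  𝟙-+ (yes p) (no  _) R? _ f _ _ = sym (𝟙-yes R? (f p))
  𝟙-+ (no  _) (yes q) R? _ _ g _ = sym (𝟙-yes R? (g q))
  𝟙-+ (no ¬p) (no ¬q) R? c _ _ _ = sym (𝟙-no R? (Sum.[ ¬p , ¬q ] ∘ c))

-- Letters and cuts of a permutation

ℕPerm : Set
ℕPerm = ℕ ↔ ℕ

-- The arc (i , v) is nested by the arc (j , s j).
NestedArc : (ℕ → ℕ) → (i v j : ℕ) → Set
NestedArc s i v j = (j < i × i ≤ v × v < s j) ⊎ (i < j × v < i × s j < v)

nestedArc? : ∀ s i v j → Dec (NestedArc s i v j)
nestedArc? s i v j =
  (j <? i ×-dec i ≤? v ×-dec v <? s j) ⊎-dec (i <? j ×-dec v <? i ×-dec s j <? v)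

nesting : ℕ → ℕPerm → ℕ → ℕ
nesting n s x = ∑ n λ j → 𝟙 (nestedArc? (to s) (from s x) x j)

letter : ℕ → ℕPerm → ℕ → Letter
letter n s x = ⟨ does (x ≤? to s x) , does (from s x ≤? x) , nesting n s x ⟩

codeFrom : ℕ → ℕPerm → ℕ → ℕ → List Letter
codeFrom n s x zero    = []
codeFrom n s x (suc m) = letter n s x ∷ codeFrom n s (suc x) m

code : ℕ → ℕPerm → List Letter
code n s = codeFrom n s 0 n

length-codeFrom : ∀ n s x m → length (codeFrom n s x m) ≡ m
length-codeFrom n s x zero    = refl
length-codeFrom n s x (suc m) = cong suc (length-codeFrom n s (suc x) m)

codeFrom-++ : ∀ n s x m k → codeFrom n s x (m + k) ≡ codeFrom n s x m ++ codeFrom n s (x + m) k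
codeFrom-++ n s x zero    k rewrite +-identityʳ x = refl
codeFrom-++ n s x (suc m) k rewrite +-suc x m     = cong (_ ∷_) (codeFrom-++ n s (suc x) m k)

codeFrom-lookup : ∀ {n s x n′ t y} m → codeFrom n s x m ≡ codeFrom n′ t y m →
                  ∀ {i} → i < m → letter n s (x + i) ≡ letter n′ t (y + i)
codeFrom-lookup {x = x} {y = y} (suc m) eq {zero} _
  rewrite +-identityʳ x | +-identityʳ y = proj₁ (∷-injective eq)
codeFrom-lookup {x = x} {y = y} (suc m) eq {suc i} (s≤s i<m)
  rewrite +-suc x i | +-suc y i = codeFrom-lookup m (proj₂ (∷-injective eq)) i<m

total-codeFrom : ∀ n s x m → total (codeFrom n s x m) ≡ ∑ m (λ i → nesting n s (x + i))
total-codeFrom n s x zero    = refl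
total-codeFrom n s x (suc m) = cong₂ _+_ (cong (nesting n s) (sym (+-identityʳ x)))
  (trans (total-codeFrom n s (suc x) m) (∑-cong m λ {i} _ → cong (nesting n s) (sym (+-suc x i))))

-- A boundary between blocks: a permutation has a factor on an interval exactly when it has cuts at
-- both ends of it.
record Cut (s : ℕPerm) (k : ℕ) : Set where
  field
    to-<   : ∀ {x} → x < k → to s x < k
    from-< : ∀ {x} → x < k → from s x < k

  to-≥ : ∀ {x} → k ≤ x → k ≤ to s x
  to-≥ {x} k≤x = ≮⇒≥ λ lt →
    <⇒≱ (subst (_< k) (strictlyInverseʳ s x) (from-< lt)) k≤x

  from-≥ : ∀ {x} → k ≤ x → k ≤ from s x
  from-≥ {x} k≤x = ≮⇒≥ λ lt →
    <⇒≱ (subst (_< k) (strictlyInverseˡ s x) (to-< lt)) k≤x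

open Cut

module Encode (n : ℕ) (s : ℕPerm) (fin : Cut s n) where

  private
    σ σ⁻ : ℕ → ℕ
    σ  = to s
    σ⁻ = from s

    σσ⁻ : ∀ x → σ (σ⁻ x) ≡ x
    σσ⁻ = strictlyInverseˡ s

    σ⁻σ : ∀ x → σ⁻ (σ x) ≡ x
    σ⁻σ = strictlyInverseʳ s

  up? : ∀ x j → Dec (j < x × x ≤ σ j)
  up? x j = j <? x ×-dec x ≤? σ j

  down? : ∀ x j → Dec (x ≤ j × σ j < x)
  down? x j = x ≤? j ×-dec σ j <? x

  -- The height of the path before the letter of `x`, counted by the arcs that cross to the right
  -- there or by those that cross back; the two counts agree by `ups≡downs`.
  ups downs : ℕ → ℕ
  ups   x = ∑ n λ j → 𝟙 (up? x j)
  downs x = ∑ n λ j → 𝟙 (down? x j)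

  private
    ∑-point : ∀ {P : Set} {k} → k < n → (P? : Dec P) →
              ∑ n (λ j → 𝟙 (j ≟ℕ k ×-dec P?)) ≡ 𝟙 P?
    ∑-point {k = k} k<n P? = trans
      (∑-single n k<n λ {i} _ i≢k → 𝟙-no (i ≟ℕ k ×-dec P?) (i≢k ∘ proj₁))
      (cong bit (does-cong (k ≟ℕ k ×-dec P?) P? proj₂ (refl ,_)))

    exchange : ∀ {A B C D R : ℕ → Set}
      (A? : ∀ j → Dec (A j)) (B? : ∀ j → Dec (B j)) (C? : ∀ j → Dec (C j)) (D? : ∀ j → Dec (D j))
      (R? : ∀ j → Dec (R j)) →
      (∀ j → 𝟙 (A? j) + 𝟙 (B? j) ≡ 𝟙 (R? j)) → (∀ j → 𝟙 (C? j) + 𝟙 (D? j) ≡ 𝟙 (R? j)) →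
      ∑ n (𝟙 ∘ A?) + ∑ n (𝟙 ∘ B?) ≡ ∑ n (𝟙 ∘ C?) + ∑ n (𝟙 ∘ D?)
    exchange A? B? C? D? R? AB CD =
      trans (sym (∑-distrib-+ n _ _)) (trans (∑-cong n λ {j} _ → trans (AB j) (sym (CD j)))
        (∑-distrib-+ n _ _))

    ≡σ⁻ : ∀ {x j} → σ j ≡ x → j ≡ σ⁻ x
    ≡σ⁻ {x} {j} eq = trans (sym (σ⁻σ j)) (cong σ⁻ eq)

  -- Both sides count the `j` with `j ≤ x ≤ σ j`. The left one separates the arc that starts at `x`,
  -- the right one the arc that ends there.
  ups-suc : ∀ {x} → x < n → ups x + 𝟙 (x ≤? σ x) ≡ ups (suc x) + 𝟙 (σ⁻ x ≤? x)
  ups-suc {x} x<n = subst₂ (λ a b → ups x + a ≡ ups (suc x) + b)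
    (∑-point x<n (x ≤? σ x)) (∑-point (from-< fin x<n) (σ⁻ x ≤? x))
    (exchange (up? x) (λ j → j ≟ℕ x ×-dec x ≤? σ x) (up? (suc x)) (λ j → j ≟ℕ σ⁻ x ×-dec σ⁻ x ≤? x)
      (λ j → j ≤? x ×-dec x ≤? σ j)
      (λ j → 𝟙-+ (up? x j) (j ≟ℕ x ×-dec x ≤? σ x) (j ≤? x ×-dec x ≤? σ j)
        (λ { (j≤x , x≤) → split₁ j≤x x≤ })
        (λ { (j<x , x≤) → <⇒≤ j<x , x≤ }) (λ { (refl , x≤) → ≤-refl , x≤ })
        (λ { ((j<x , _) , (refl , _)) → <-irrefl refl j<x }))
      (λ j → 𝟙-+ (up? (suc x) j) (j ≟ℕ σ⁻ x ×-dec σ⁻ x ≤? x) (j ≤? x ×-dec x ≤? σ j)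
        (λ { (j≤x , x≤) → split₂ j≤x x≤ })
        (λ { (s≤s j≤x , x<) → j≤x , <⇒≤ x< })
        (λ { (refl , x≤) → x≤ , ≤-reflexive (sym (σσ⁻ x)) })
        (λ { ((_ , x<) , (refl , _)) → <-irrefl (sym (σσ⁻ x)) x< })))
    where
    split₁ : ∀ {j} → j ≤ x → x ≤ σ j → (j < x × x ≤ σ j) ⊎ (j ≡ x × x ≤ σ x)
    split₁ j≤x x≤ with m≤n⇒m<n∨m≡n j≤x
    ... | inj₁ j<x  = inj₁ (j<x , x≤)
    ... | inj₂ refl = inj₂ (refl , x≤)
    split₂ : ∀ {j} → j ≤ x → x ≤ σ j → (j < suc x × x < σ j) ⊎ (j ≡ σ⁻ x × σ⁻ x ≤ x)
    split₂ j≤x x≤ with m≤n⇒m<n∨m≡n x≤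
    ... | inj₁ x< = inj₁ (s≤s j≤x , x<)
    ... | inj₂ eq with refl ← ≡σ⁻ (sym eq) = inj₂ (refl , j≤x)

  -- Both sides count the `j` with `σ j ≤ x ≤ j`.
  downs-suc : ∀ {x} → x < n → downs x + 𝟙 (x ≤? σ⁻ x) ≡ downs (suc x) + 𝟙 (σ x ≤? x)
  downs-suc {x} x<n = subst₂ (λ a b → downs x + a ≡ downs (suc x) + b)
    (∑-point (from-< fin x<n) (x ≤? σ⁻ x)) (∑-point x<n (σ x ≤? x))
    (exchange (down? x) (λ j → j ≟ℕ σ⁻ x ×-dec x ≤? σ⁻ x) (down? (suc x)) (λ j → j ≟ℕ x ×-dec σ x ≤? x)
      (λ j → x ≤? j ×-dec σ j ≤? x)
      (λ j → 𝟙-+ (down? x j) (j ≟ℕ σ⁻ x ×-dec x ≤? σ⁻ x) (x ≤? j ×-dec σ j ≤? x)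
        (λ { (x≤j , ≤x) → split₁ x≤j ≤x })
        (λ { (x≤j , <x) → x≤j , <⇒≤ <x }) (λ { (refl , x≤) → x≤ , ≤-reflexive (σσ⁻ x) })
        (λ { ((_ , <x) , (refl , _)) → <-irrefl (σσ⁻ x) <x }))
      (λ j → 𝟙-+ (down? (suc x) j) (j ≟ℕ x ×-dec σ x ≤? x) (x ≤? j ×-dec σ j ≤? x)
        (λ { (x≤j , ≤x) → split₂ x≤j ≤x })
        (λ { (x<j , s≤s ≤x) → <⇒≤ x<j , ≤x })
        (λ { (refl , ≤x) → ≤-refl , ≤x })
        (λ { ((x<j , _) , (refl , _)) → <-irrefl refl x<j })))
    where
    split₁ : ∀ {j} → x ≤ j → σ j ≤ x → (x ≤ j × σ j < x) ⊎ (j ≡ σ⁻ x × x ≤ σ⁻ x)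
    split₁ x≤j ≤x with m≤n⇒m<n∨m≡n ≤x
    ... | inj₁ <x = inj₁ (x≤j , <x)
    ... | inj₂ eq with refl ← ≡σ⁻ eq = inj₂ (refl , x≤j)
    split₂ : ∀ {j} → x ≤ j → σ j ≤ x → (x < j × σ j < suc x) ⊎ (j ≡ x × σ x ≤ x)
    split₂ x≤j ≤x with m≤n⇒m<n∨m≡n x≤j
    ... | inj₁ x<j  = inj₁ (x<j , s≤s ≤x)
    ... | inj₂ refl = inj₂ (refl , ≤x)

  ups-zero : ups 0 ≡ 0
  ups-zero = ∑-zero n λ {j} _ → 𝟙-no (up? 0 j) λ { (() , _) }

  private
    dichotomy : ∀ x y → 𝟙 (x ≤? y) + 𝟙 (y ≤? x) ≡ 1 + 𝟙 (x ≟ℕ y)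
    dichotomy x y with <-cmp x y
    ... | tri< x<y x≢y _ = trans (cong₂ _+_ (𝟙-yes (x ≤? y) (<⇒≤ x<y)) (𝟙-no (y ≤? x) (<⇒≱ x<y)))
                                 (cong suc (sym (𝟙-no (x ≟ℕ y) x≢y)))
    ... | tri> _ x≢y y<x = trans (cong₂ _+_ (𝟙-no (x ≤? y) (<⇒≱ y<x)) (𝟙-yes (y ≤? x) (<⇒≤ y<x)))
                                 (cong suc (sym (𝟙-no (x ≟ℕ y) x≢y)))
    ... | tri≈ _ refl _  = trans (cong₂ _+_ (𝟙-yes (x ≤? x) ≤-refl) (𝟙-yes (x ≤? x) ≤-refl))
                                 (cong suc (sym (𝟙-yes (x ≟ℕ x) refl)))

    -- Both sums are 1, or 2 if `x` is a fixed point.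
    fixed : ∀ x → 𝟙 (x ≤? σ x) + 𝟙 (σ x ≤? x) ≡ 𝟙 (x ≤? σ⁻ x) + 𝟙 (σ⁻ x ≤? x)
    fixed x = trans (dichotomy x (σ x)) (trans (cong suc (cong bit (does-cong (x ≟ℕ σ x) (x ≟ℕ σ⁻ x)
      (λ eq → ≡σ⁻ (sym eq)) (λ eq → trans (sym (σσ⁻ x)) (cong σ (sym eq))))))
      (sym (dichotomy x (σ⁻ x))))

  ups≡downs : ∀ {x} → x ≤ n → ups x ≡ downs x
  ups≡downs {zero}  _   = trans ups-zero (sym (∑-zero n λ {j} _ → 𝟙-no (down? 0 j) λ { (_ , ()) }))
  ups≡downs {suc x} x<n = +-cancelʳ-≡ (a⁻ + b) _ _ (begin
    ups (suc x) + (a⁻ + b)    ≡⟨ +-assoc _ a⁻ b ⟨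
    ups (suc x) + a⁻ + b      ≡⟨ cong (_+ b) (ups-suc x<n) ⟨
    ups x + a + b             ≡⟨ +-assoc _ a b ⟩
    ups x + (a + b)           ≡⟨ cong₂ _+_ (ups≡downs (<⇒≤ x<n)) (fixed x) ⟩
    downs x + (b⁻ + a⁻)       ≡⟨ +-assoc _ b⁻ a⁻ ⟨
    downs x + b⁻ + a⁻         ≡⟨ cong (_+ a⁻) (downs-suc x<n) ⟩
    downs (suc x) + b + a⁻    ≡⟨ +-assoc _ b a⁻ ⟩
    downs (suc x) + (b + a⁻)  ≡⟨ cong (_+_ (downs (suc x))) (+-comm b a⁻) ⟩
    downs (suc x) + (a⁻ + b)  ∎)
    where
    open ≡-Reasoning
    a  = 𝟙 (x ≤? σ x)
    b  = 𝟙 (σ x ≤? x)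
    a⁻ = 𝟙 (σ⁻ x ≤? x)
    b⁻ = 𝟙 (x ≤? σ⁻ x)

  private
    arc? : ∀ x j → Dec (NestedArc σ (σ⁻ x) x j)
    arc? x j = nestedArc? σ (σ⁻ x) x j

    nested⇒up : ∀ {x j} → σ⁻ x ≤ x → NestedArc σ (σ⁻ x) x j → j < x × x ≤ σ j
    nested⇒up i≤x (inj₁ (j<i , _ , x<))  = ≤-trans j<i i≤x , <⇒≤ x<
    nested⇒up i≤x (inj₂ (_ , x<i , _)) = contradiction i≤x (<⇒≱ x<i)

    nested⇒down : ∀ {x j} → x < σ⁻ x → NestedArc σ (σ⁻ x) x j → x ≤ j × σ j < x
    nested⇒down x<i (inj₁ (_ , i≤x , _))  = contradiction i≤x (<⇒≱ x<i)
    nested⇒down x<i (inj₂ (i<j , _ , <x)) = <⇒≤ (<-trans x<i i<j) , <x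

    not-self : ∀ {x} → ¬ NestedArc σ (σ⁻ x) x (σ⁻ x)
    not-self (inj₁ (lt , _)) = <-irrefl refl lt
    not-self (inj₂ (lt , _)) = <-irrefl refl lt

  -- The arcs nesting the arc that ends at `x` are among those counted by `ups x` if `x` closes, and
  -- by `downs x`, the same number, if it does not. If `x` does not open, the inclusion is strict:
  -- in the first case the arc ending at `x`, in the second the arc starting at `x`, is counted
  -- without nesting.
  nesting-bound : ∀ {x} → x < n → nesting n s x + bit (not (does (x ≤? σ x))) ≤ ups x
  nesting-bound {x} x<n = bound (x ≤? σ x) (σ⁻ x ≤? x)
    where
    bound : (o? : Dec (x ≤ σ x)) → Dec (σ⁻ x ≤ x) → nesting n s x + bit (not (does o?)) ≤ ups x
    bound (yes x≤) (yes i≤x) = ≤-trans (≤-reflexive (+-identityʳ _))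
      (∑-mono n λ {j} _ → 𝟙-mono (arc? x j) (up? x j) (nested⇒up i≤x))
    bound (yes x≤) (no i≰x) = ≤-trans (≤-reflexive (+-identityʳ _)) (≤-trans
      (∑-mono n λ {j} _ → 𝟙-mono (arc? x j) (down? x j) (nested⇒down (≰⇒> i≰x)))
      (≤-reflexive (sym (ups≡downs (<⇒≤ x<n)))))
    bound (no x≰) (yes i≤x) = ≤-trans (≤-reflexive (+-comm _ 1))
      (∑-mono-< n (λ {j} _ → 𝟙-mono (arc? x j) (up? x j) (nested⇒up i≤x)) (from-< fin x<n)
        (𝟙-< (arc? x (σ⁻ x)) (up? x (σ⁻ x)) not-self
          (≤∧≢⇒< i≤x (λ i≡x → x≰ (≤-reflexive (trans (sym (σσ⁻ x)) (cong σ i≡x))))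
          , ≤-reflexive (sym (σσ⁻ x)))))
    bound (no x≰) (no i≰x) = ≤-trans (≤-reflexive (+-comm _ 1)) (≤-trans
      (∑-mono-< n (λ {j} _ → 𝟙-mono (arc? x j) (down? x j) (nested⇒down (≰⇒> i≰x))) x<n
        (𝟙-< (arc? x x) (down? x x)
          (λ { (inj₁ (_ , i≤x , _)) → i≰x i≤x ; (inj₂ (i<x , _)) → i≰x (<⇒≤ i<x) })
          (≤-refl , ≰⇒> x≰)))
      (≤-reflexive (sym (ups≡downs (<⇒≤ x<n)))))

  history : ∀ x m → x + m ≤ n → History (ups x) (codeFrom n s x m) (ups (x + m))
  history x zero    _ rewrite +-identityʳ x = []
  history x (suc m) le rewrite +-suc x m =
    step (nesting-bound x<n) (ups-suc x<n) (history (suc x) m le)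
    where
    x<n : x < n
    x<n = ≤-trans (s≤s (m≤m+n x m)) le

  cut⇒ups : ∀ {k} → Cut s k → ups k ≡ 0
  cut⇒ups {k} c = ∑-zero n λ {j} _ → 𝟙-no (up? k j) λ { (j<k , k≤) → <⇒≱ (to-< c j<k) k≤ }

  -- At height 0 no arc crosses to the right and, by `ups≡downs`, none crosses back; the latter
  -- bounds the inverse.
  ups⇒cut : ∀ {k} → k ≤ n → ups k ≡ 0 → Cut s k
  ups⇒cut {k} k≤n eq = record
    { to-<   = λ {x} x<k → ≰⇒> λ k≤ → 𝟙-zero (up? k x)
        (n≤0⇒n≡0 (≤-trans (term≤∑ n (≤-trans x<k k≤n)) (≤-reflexive eq))) (x<k , k≤)
    ; from-< = λ {x} x<k → ≰⇒> λ k≤ → 𝟙-zero (down? k (σ⁻ x))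
        (n≤0⇒n≡0 (≤-trans (term≤∑ n (from-< fin (≤-trans x<k k≤n)))
          (≤-reflexive (trans (sym (ups≡downs k≤n)) eq))))
        (k≤ , subst (_< k) (sym (σσ⁻ x)) x<k)
    }

  code-history : History 0 (code n s) 0
  code-history = subst₂ (λ h k → History h (code n s) k) ups-zero (cut⇒ups fin) (history 0 n ≤-refl)

  -- No arc nests that of 0, which ends at `σ 0`. A smaller value either does not close or ends an
  -- arc nested by that of 0. The recursion is on the distance `d` from `x` to `σ 0`.
  firstZero-code : 0 < n → ∀ d x m → x + d ≡ σ 0 → d < m → firstZero (codeFrom n s x m) ≡ d
  firstZero-code _ zero x (suc m) eq _ rewrite +-identityʳ x | eq =
    first (dec-true (σ⁻ (σ 0) ≤? σ 0) (subst (_≤ σ 0) (sym (σ⁻σ 0)) z≤n))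
      (∑-zero n λ {j} _ → 𝟙-no (arc? (σ 0) j) λ
        { (inj₁ (j<i , _)) → contradiction (subst (j <_) (σ⁻σ 0) j<i) λ ()
        ; (inj₂ (_ , lt , _)) → contradiction (subst (σ 0 <_) (σ⁻σ 0) lt) λ () })
    where
    first : ∀ {o c r w} → c ≡ true → r ≡ 0 → firstZero (⟨ o , c , r ⟩ ∷ w) ≡ 0
    first refl refl = refl
  firstZero-code 0<n (suc d) x (suc m) eq (s≤s d<m) =
    trans (later (does-closes (σ⁻ x ≤? x)))
      (cong suc (firstZero-code 0<n d (suc x) m (trans (sym (+-suc x d)) eq) d<m))
    where
    x<σ0 : x < σ 0
    x<σ0 = subst (x <_) eq (m<m+n x (s≤s z≤n))
    i≢0 : σ⁻ x ≢ 0
    i≢0 i≡0 = <-irrefl (trans (sym (σσ⁻ x)) (cong σ i≡0)) x<σ0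
    does-closes : (D : Dec (σ⁻ x ≤ x)) → does D ≡ false ⊎ 0 < nesting n s x
    does-closes (no _)    = inj₁ refl
    does-closes (yes i≤x) = inj₂ (≤-trans
      (≤-reflexive (sym (𝟙-yes (arc? x 0) (inj₁ (n≢0⇒n>0 i≢0 , i≤x , x<σ0)))))
      (term≤∑ n {λ j → 𝟙 (arc? x j)} 0<n))
    later : ∀ {o c r w} → c ≡ false ⊎ 0 < r → firstZero (⟨ o , c , r ⟩ ∷ w) ≡ suc (firstZero w)
    later {c = false}             _ = refl
    later {c = true} {r = suc r}  _ = refl
    later {c = true} {r = zero} (inj₂ ())

-- A history determines its permutation

record Alike (k : ℕ) (s t : ℕPerm) : Set where
  field
    cutˡ    : Cut s k
    cutʳ    : Cut t k
    letters : ∀ {x} → x < k → letter k s x ≡ letter k t x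

  opens⇒ : ∀ {x} → x < k → x ≤ to s x → x ≤ to t x
  opens⇒ {x} x<k = does-transport (x ≤? to s x) (x ≤? to t x) (cong opens (letters x<k))

  closes⇒ : ∀ {x} → x < k → from s x ≤ x → from t x ≤ x
  closes⇒ {x} x<k = does-transport (from s x ≤? x) (from t x ≤? x) (cong closes (letters x<k))

Alike-sym : ∀ {k s t} → Alike k s t → Alike k t s
Alike-sym A = record { cutˡ = A.cutʳ ; cutʳ = A.cutˡ ; letters = sym ∘ A.letters }
  where module A = Alike A

-- If `from s y` were smaller, every start of an arc nesting the one to `y` in `s` would also start
-- an arc nesting the one to `y` in `t`, and so would `from s y` itself: the labels at `y` would
-- differ. Agreement at the smaller values ensures that none of these arcs of `t` ends before `y`.
up-≮ : ∀ {k s t} → Alike k s t → ∀ {y} → y < k → from s y ≤ y → from t y ≤ y →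
       (∀ {v} → v < y → from t v ≤ v → from s v ≡ from t v) → ¬ from s y < from t y
up-≮ {k} {s} {t} A {y} y<k i≤y i′≤y IH i<i′ = <⇒≢
  (∑-mono-< k
    (λ {j} _ → 𝟙-mono (nestedArc? (to s) i y j) (nestedArc? (to t) i′ y j) λ
      { (inj₁ (j<i , _ , y<)) → inj₁ (<-trans j<i i<i′ , i′≤y ,
          above (<-trans j<i i<i′) (≤-trans (<⇒≤ j<i) (≤-trans i≤y (<⇒≤ y<))) (<⇒≤ y<))
      ; (inj₂ (_ , y<i , _)) → contradiction i≤y (<⇒≱ y<i) })
    (from-< cutˡ y<k)
    (𝟙-< (nestedArc? (to s) i y i) (nestedArc? (to t) i′ y i)
      (λ { (inj₁ (lt , _)) → <-irrefl refl lt ; (inj₂ (lt , _)) → <-irrefl refl lt })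
      (inj₁ (i<i′ , i′≤y , above i<i′ (≤-trans i≤y y≤si) y≤si))))
  (cong label (letters y<k))
  where
  open Alike A
  i i′ : ℕ
  i  = from s y
  i′ = from t y
  y≤si : y ≤ to s i
  y≤si = ≤-reflexive (sym (strictlyInverseˡ s y))
  above : ∀ {j} → j < i′ → j ≤ to s j → y ≤ to s j → y < to t j
  above {j} j<i′ j≤sj y≤sj = ≰⇒> λ tj≤y → case (m≤n⇒m<n∨m≡n tj≤y)
    where
    j≤tj : j ≤ to t j
    j≤tj = opens⇒ (<-≤-trans j<i′ (≤-trans i′≤y (<⇒≤ y<k))) j≤sj
    t⁻tj : from t (to t j) ≡ j
    t⁻tj = strictlyInverseʳ t j
    case : ¬ (to t j < y ⊎ to t j ≡ y)
    case (inj₂ eq) = <-irrefl (trans (sym t⁻tj) (cong (from t) eq)) j<i′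
    case (inj₁ lt) = <⇒≱ lt (≤-trans y≤sj (≤-reflexive
      (trans (cong (to s) (sym (trans (IH lt (subst (_≤ to t j) (sym t⁻tj) j≤tj)) t⁻tj)))
             (strictlyInverseˡ s (to t j)))))

-- The mirror image of `up-≮`, with agreement assumed at larger values. Here the nesting arcs of `t`
-- are carried over to `s`, and `from t y` starts the additional one.
down-≮ : ∀ {k s t} → Alike k s t → ∀ {y} → y < k → y < from s y → y < from t y →
         (∀ {v} → y < v → v < k → v < from s v → from s v ≡ from t v) → ¬ from s y < from t y
down-≮ {k} {s} {t} A {y} y<k y<i y<i′ IH i<i′ = <⇒≢
  (∑-mono-< k
    (λ {j} j<k → 𝟙-mono (nestedArc? (to t) i′ y j) (nestedArc? (to s) i y j) λ
      { (inj₁ (_ , i′≤y , _)) → contradiction i′≤y (<⇒≱ y<i′)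
      ; (inj₂ (i′<j , _ , <y)) → inj₂ (<-trans i<i′ i′<j , y<i ,
          below (<-trans i<i′ i′<j) j<k (<-trans <y (<-trans y<i′ i′<j)) (<⇒≤ <y)) })
    (from-< cutʳ y<k)
    (𝟙-< (nestedArc? (to t) i′ y i′) (nestedArc? (to s) i y i′)
      (λ { (inj₁ (lt , _)) → <-irrefl refl lt ; (inj₂ (lt , _)) → <-irrefl refl lt })
      (inj₂ (i<i′ , y<i , below i<i′ (from-< cutʳ y<k) (≤-<-trans ti′≤y y<i′) ti′≤y))))
  (sym (cong label (letters y<k)))
  where
  open Alike A
  i i′ : ℕ
  i  = from s y
  i′ = from t y
  ti′≤y : to t i′ ≤ y
  ti′≤y = ≤-reflexive (strictlyInverseˡ t y)
  below : ∀ {j} → i < j → j < k → to t j < j → to t j ≤ y → to s j < y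
  below {j} i<j j<k tj<j tj≤y = ≰⇒> λ y≤sj → case (m≤n⇒m<n∨m≡n y≤sj)
    where
    s⁻sj : from s (to s j) ≡ j
    s⁻sj = strictlyInverseʳ s j
    sj<j : to s j < j
    sj<j = ≰⇒> λ j≤sj → <⇒≱ tj<j (opens⇒ j<k j≤sj)
    case : ¬ (y < to s j ⊎ y ≡ to s j)
    case (inj₂ eq) = <-irrefl (trans (cong (from s) eq) s⁻sj) i<j
    case (inj₁ lt) = <⇒≱ lt (≤-trans (≤-reflexive (trans (sym (strictlyInverseˡ t (to s j)))
      (cong (to t) (trans (sym (IH lt (to-< cutˡ j<k) (subst (to s j <_) (sym s⁻sj) sj<j))) s⁻sj))))
      tj≤y)

module _ {k s t} (A : Alike k s t) where

  private
    B : Alike k t s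
    B = Alike-sym A
    module A = Alike A
    module B = Alike B

  ups-agree : ∀ f {y} → y < f → y < k → from s y ≤ y → from s y ≡ from t y
  ups-agree (suc f) {y} (s≤s y≤f) y<k i≤y with <-cmp (from s y) (from t y)
  ... | tri≈ _ eq _ = eq
  ... | tri< lt _ _ = contradiction lt (up-≮ A y<k i≤y (A.closes⇒ y<k i≤y) λ v<y c →
    ups-agree f (<-≤-trans v<y y≤f) (<-trans v<y y<k) (B.closes⇒ (<-trans v<y y<k) c))
  ... | tri> _ _ gt = contradiction gt (up-≮ B y<k (A.closes⇒ y<k i≤y) i≤y λ v<y c →
    sym (ups-agree f (<-≤-trans v<y y≤f) (<-trans v<y y<k) c))

  private
    opened : ∀ {y} → y < k → y < from s y → y < from t y
    opened y<k y<i = ≰⇒> λ c → <⇒≱ y<i (B.closes⇒ y<k c)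

    later : ∀ f {y v} → k ≤ y + suc f → y < v → k ≤ v + f
    later f {y} le y<v = ≤-trans le (≤-trans (≤-reflexive (+-suc y f)) (+-monoˡ-≤ f y<v))

  -- A descending induction on `y`, in which `f` bounds the distance to `k`.
  downs-agree : ∀ f {y} → k ≤ y + f → y < k → y < from s y → from s y ≡ from t y
  downs-agree zero {y} le y<k _ = contradiction (subst (k ≤_) (+-identityʳ y) le) (<⇒≱ y<k)
  downs-agree (suc f) {y} le y<k y<i with <-cmp (from s y) (from t y)
  ... | tri≈ _ eq _ = eq
  ... | tri< lt _ _ = contradiction lt (down-≮ A y<k y<i (opened y<k y<i) λ y<v v<k o →
    downs-agree f (later f le y<v) v<k o)
  ... | tri> _ _ gt = contradiction gt (down-≮ B y<k (opened y<k y<i) y<i λ y<v v<k o →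
    sym (downs-agree f (later f le y<v) v<k (≰⇒> λ c → <⇒≱ o (A.closes⇒ v<k c))))

  Alike⇒from≡ : ∀ {y} → y < k → from s y ≡ from t y
  Alike⇒from≡ {y} y<k with from s y ≤? y
  ... | yes i≤y = ups-agree (suc y) ≤-refl y<k i≤y
  ... | no  i≰y = downs-agree k (m≤n+m k y) y<k (≰⇒> i≰y)

  Alike⇒to≡ : ∀ {x} → x < k → to s x ≡ to t x
  Alike⇒to≡ {x} x<k = begin
    to s x                      ≡⟨ strictlyInverseˡ t (to s x) ⟨
    to t (from t (to s x))      ≡⟨ cong (to t) (Alike⇒from≡ (to-< A.cutˡ x<k)) ⟨
    to t (from s (to s x))      ≡⟨ cong (to t) (strictlyInverseʳ s x) ⟩
    to t x                      ∎
    where open ≡-Reasoning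

-- Restriction to an interval between cuts

module _ {s : ℕPerm} {a : ℕ} (c : Cut s a) where

  private
    to+ : ∀ x → a + (to s (a + x) ∸ a) ≡ to s (a + x)
    to+ x = m+[n∸m]≡n (to-≥ c (m≤m+n a x))

    from+ : ∀ x → a + (from s (a + x) ∸ a) ≡ from s (a + x)
    from+ x = m+[n∸m]≡n (from-≥ c (m≤m+n a x))

  shift : ℕPerm
  shift = mk↔ₛ′ (λ x → to s (a + x) ∸ a) (λ x → from s (a + x) ∸ a)
    (λ x → trans (cong (λ y → to s y ∸ a) (from+ x))
                 (trans (cong (_∸ a) (strictlyInverseˡ s (a + x))) (m+n∸m≡n a x)))
    (λ x → trans (cong (λ y → from s y ∸ a) (to+ x))
                 (trans (cong (_∸ a) (strictlyInverseʳ s (a + x))) (m+n∸m≡n a x)))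

  to-shift : ∀ x → to s (a + x) ≡ a + to shift x
  to-shift x = sym (to+ x)

  from-shift : ∀ x → from s (a + x) ≡ a + from shift x
  from-shift x = sym (from+ x)

  Cut-shift : ∀ {k} → Cut s (a + k) → Cut shift k
  Cut-shift {k} d = record
    { to-<   = λ {x} x<k → +-cancelˡ-< a _ _ (subst (_< a + k) (to-shift x) (to-< d (+-monoʳ-< a x<k)))
    ; from-< = λ {x} x<k → +-cancelˡ-< a _ _ (subst (_< a + k) (from-shift x) (from-< d (+-monoʳ-< a x<k)))
    }

  -- Arcs that start below the cut also end below it, so they nest none of the arcs beyond it.
  letter-shift : ∀ n x → letter (a + n) s (a + x) ≡ letter n shift x
  letter-shift n x = letter-cong
    (does-cong (a + x ≤? to s (a + x)) (x ≤? to shift x)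
      (λ le → +-cancelˡ-≤ a _ _ (subst (a + x ≤_) (to-shift x) le))
      (λ le → subst (a + x ≤_) (sym (to-shift x)) (+-monoʳ-≤ a le)))
    (does-cong (from s (a + x) ≤? a + x) (i ≤? x)
      (λ le → +-cancelˡ-≤ a _ _ (subst (_≤ a + x) (from-shift x) le))
      (λ le → subst (_≤ a + x) (sym (from-shift x)) (+-monoʳ-≤ a le)))
    (begin
      nesting (a + n) s (a + x)
        ≡⟨ cong (λ i → ∑ (a + n) λ j → 𝟙 (nestedArc? (to s) i (a + x) j)) (from-shift x) ⟩
      ∑ (a + n) f ≡⟨ ∑-split a n f ⟩
      ∑ a f + ∑ n (λ j → f (a + j)) ≡⟨ cong (_+ ∑ n (λ j → f (a + j))) (∑-zero a outside) ⟩
      ∑ n (λ j → f (a + j)) ≡⟨ ∑-cong n (λ {j} _ → inside j) ⟩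
      ∑ n (λ j → 𝟙 (nestedArc? (to shift) i x j)) ∎)
    where
    open ≡-Reasoning
    i : ℕ
    i = from shift x
    f : ℕ → ℕ
    f j = 𝟙 (nestedArc? (to s) (a + i) (a + x) j)
    letter-cong : ∀ {o o′ c c′ r r′} → o ≡ o′ → c ≡ c′ → r ≡ r′ →
                   ⟨ o , c , r ⟩ ≡ ⟨ o′ , c′ , r′ ⟩
    letter-cong refl refl refl = refl
    outside : ∀ {j} → j < a → f j ≡ 0
    outside {j} j<a = 𝟙-no (nestedArc? (to s) (a + i) (a + x) j) λ
      { (inj₁ (_ , _ , lt)) → <⇒≱ (to-< c j<a) (≤-trans (m≤m+n a x) (<⇒≤ lt))
      ; (inj₂ (lt , _))     → <⇒≱ j<a (≤-trans (m≤m+n a i) (<⇒≤ lt)) }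
    inside : ∀ j → f (a + j) ≡ 𝟙 (nestedArc? (to shift) i x j)
    inside j = cong bit (does-cong
      (nestedArc? (to s) (a + i) (a + x) (a + j)) (nestedArc? (to shift) i x j)
      (λ { (inj₁ (p , q , r)) → inj₁ (+-cancelˡ-< a _ _ p , +-cancelˡ-≤ a _ _ q ,
             +-cancelˡ-< a _ _ (subst (a + x <_) (to-shift j) r))
         ; (inj₂ (p , q , r)) → inj₂ (+-cancelˡ-< a _ _ p , +-cancelˡ-< a _ _ q ,
             +-cancelˡ-< a _ _ (subst (_< a + x) (to-shift j) r)) })
      (λ { (inj₁ (p , q , r)) → inj₁ (+-monoʳ-< a p , +-monoʳ-≤ a q ,
             subst (a + x <_) (sym (to-shift j)) (+-monoʳ-< a r))
         ; (inj₂ (p , q , r)) → inj₂ (+-monoʳ-< a p , +-monoʳ-< a q ,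
             subst (_< a + x) (sym (to-shift j)) (+-monoʳ-< a r)) }))

letter-restrict : ∀ {s k} → Cut s k → ∀ m {x} → x < k → letter (k + m) s x ≡ letter k s x
letter-restrict {s} {k} c m {x} x<k = cong ⟨ _ , _ ,_⟩ (begin
  ∑ (k + m) f                    ≡⟨ ∑-split k m f ⟩
  ∑ k f + ∑ m (λ j → f (k + j))  ≡⟨ cong (_+_ (∑ k f)) (∑-zero m λ {j} _ → outside j) ⟩
  ∑ k f + 0                      ≡⟨ +-identityʳ _ ⟩
  ∑ k f                          ∎)
  where
  open ≡-Reasoning
  f : ℕ → ℕ
  f j = 𝟙 (nestedArc? (to s) (from s x) x j)
  outside : ∀ j → f (k + j) ≡ 0
  outside j = 𝟙-no (nestedArc? (to s) (from s x) x (k + j)) λ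
    { (inj₁ (lt , _))     → <⇒≱ (<-trans lt (from-< c x<k)) (m≤m+n k j)
    ; (inj₂ (_ , _ , lt)) → <⇒≱ (<-trans lt x<k) (to-≥ c (m≤m+n k j)) }

-- Comparing a block of `s` with a whole `t` covers two uses: equality of permutations, with `a` and
-- `m` equal to 0, and recognition of a factor.
code-injective : ∀ {s t} a k m → Cut s a → Cut s (a + k) → Cut t k →
                 codeFrom (a + (k + m)) s a k ≡ code k t →
                 ∀ {x} → x < k → to s (a + x) ≡ a + to t x
code-injective {s} {t} a k m ca cak ct eq {x} x<k =
  trans (to-shift ca x) (cong (_+_ a) (Alike⇒to≡ A x<k))
  where
  A : Alike k (shift ca) t
  A = record
    { cutˡ    = Cut-shift ca cak
    ; cutʳ    = ct
    ; letters = λ {y} y<k → begin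
        letter k (shift ca) y              ≡⟨ letter-restrict (Cut-shift ca cak) m y<k ⟨
        letter (k + m) (shift ca) y        ≡⟨ letter-shift ca (k + m) y ⟨
        letter (a + (k + m)) s (a + y)     ≡⟨ codeFrom-lookup k eq y<k ⟩
        letter k t y                       ∎
    }
    where open ≡-Reasoning

-- Counting

extend : ∀ {n} → (Fin n → Fin n) → ℕ → ℕ
extend {n} f x with x <? n
... | yes x<n = toℕ (f (fromℕ< x<n))
... | no  _   = x

extend-toℕ : ∀ {n} (f : Fin n → Fin n) i → extend f (toℕ i) ≡ toℕ (f i)
extend-toℕ {n} f i with toℕ i <? n
... | yes i<n = cong (toℕ ∘ f) (Fin.fromℕ<-toℕ i i<n)
... | no  i≮n = contradiction (Fin.toℕ<n i) i≮n

extend-≥ : ∀ {n} (f : Fin n → Fin n) {x} → n ≤ x → extend f x ≡ x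
extend-≥ {n} f {x} n≤x with x <? n
... | yes x<n = contradiction n≤x (<⇒≱ x<n)
... | no  _   = refl

data View (n : ℕ) : ℕ → Set where
  inside  : (i : Fin n) → View n (toℕ i)
  outside : ∀ {x} → n ≤ x → View n x

view : ∀ n x → View n x
view n x with x <? n
... | yes x<n = subst (View n) (Fin.toℕ-fromℕ< x<n) (inside (fromℕ< x<n))
... | no  x≮n = outside (≮⇒≥ x≮n)

extend-inverse : ∀ {n} {f g : Fin n → Fin n} → (∀ i → f (g i) ≡ i) →
                 ∀ x → extend f (extend g x) ≡ x
extend-inverse {n} {f} {g} fg x with view n x
... | inside i    = trans (cong (extend f) (extend-toℕ g i))
                      (trans (extend-toℕ f (g i)) (cong toℕ (fg i)))
... | outside n≤x = trans (cong (extend f) (extend-≥ g n≤x)) (extend-≥ f n≤x)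

extend-< : ∀ {n} (f : Fin n → Fin n) {x} → x < n → extend f x < n
extend-< {n} f {x} x<n with view n x
... | inside i    = subst (_< n) (sym (extend-toℕ f i)) (Fin.toℕ<n (f i))
... | outside n≤x = contradiction n≤x (<⇒≱ x<n)

⟪_⟫ : ∀ {n} → Permutation′ n → ℕPerm
⟪ σ ⟫ = mk↔ₛ′ (extend (σ ⟨$⟩ʳ_)) (extend (σ ⟨$⟩ˡ_))
  (extend-inverse λ i → inverseʳ σ) (extend-inverse λ i → inverseˡ σ)

Cut-⟪⟫ : ∀ {n} (σ : Permutation′ n) → Cut ⟪ σ ⟫ n
Cut-⟪⟫ σ = record { to-< = extend-< (σ ⟨$⟩ʳ_) ; from-< = extend-< (σ ⟨$⟩ˡ_) }

codeOf : ∀ {n} → Permutation′ n → List Letter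
codeOf {n} σ = code n ⟪ σ ⟫

codeOf-history : ∀ {n} (σ : Permutation′ n) → History 0 (codeOf σ) 0
codeOf-history {n} σ = Encode.code-history n ⟪ σ ⟫ (Cut-⟪⟫ σ)

Cut-zero : ∀ {s} → Cut s 0
Cut-zero = record { to-< = λ () ; from-< = λ () }

codeOf-injective : ∀ {n} (σ τ : Permutation′ n) → codeOf σ ≡ codeOf τ → ∀ i → σ ⟨$⟩ʳ i ≡ τ ⟨$⟩ʳ i
codeOf-injective {n} σ τ eq i = Fin.toℕ-injective (begin
  toℕ (σ ⟨$⟩ʳ i)      ≡⟨ extend-toℕ (σ ⟨$⟩ʳ_) i ⟨
  to ⟪ σ ⟫ (toℕ i)    ≡⟨ code-injective 0 n 0 Cut-zero (Cut-⟪⟫ σ) (Cut-⟪⟫ τ)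
                           (subst (λ k → codeFrom k ⟪ σ ⟫ 0 n ≡ codeOf τ) (sym (+-identityʳ n)) eq)
                           (Fin.toℕ<n i) ⟩
  to ⟪ τ ⟫ (toℕ i)    ≡⟨ extend-toℕ (τ ⟨$⟩ʳ_) i ⟩
  toℕ (τ ⟨$⟩ʳ i)      ∎)
  where open ≡-Reasoning

firstZero-codeOf : ∀ {m} (σ : Permutation′ (suc m)) → firstZero (codeOf σ) ≡ toℕ (σ ⟨$⟩ʳ zero)
firstZero-codeOf {m} σ = Encode.firstZero-code (suc m) ⟪ σ ⟫ (Cut-⟪⟫ σ) (s≤s z≤n) _ 0 (suc m)
  (sym (extend-toℕ (σ ⟨$⟩ʳ_) zero)) (Fin.toℕ<n (σ ⟨$⟩ʳ zero))

-- Nestings as the sum of the labels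

length-filter-map : ∀ {A B : Set} {P : B → Set} (P? : Decidable P) (f : A → B) xs →
                    length (filter P? (map f xs)) ≡ length (filter (P? ∘ f) xs)
length-filter-map P? f []       = refl
length-filter-map P? f (x ∷ xs) with does (P? (f x))
... | true  = cong suc (length-filter-map P? f xs)
... | false = length-filter-map P? f xs

length-filter-tabulate : ∀ {A : Set} {P : A → Set} (P? : Decidable P) {n} (f : Fin n → A) →
                         length (filter P? (tabulate f)) ≡ sum (λ i → 𝟙 (P? (f i)))
length-filter-tabulate P? {zero}  f = refl
length-filter-tabulate P? {suc n} f with does (P? (f zero))
... | true  = cong suc (length-filter-tabulate P? (f ∘ suc))
... | false = length-filter-tabulate P? (f ∘ suc)

length-filter-product : ∀ {A B : Set} {P : A × B → Set} (P? : Decidable P) {m n}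
                        (f : Fin m → A) (g : Fin n → B) →
                        length (filter P? (cartesianProduct (tabulate f) (tabulate g))) ≡
                        sum (λ i → sum (λ j → 𝟙 (P? (f i , g j))))
length-filter-product P? {zero}  f g = refl
length-filter-product P? {suc m} f g = begin
  length (filter P? (row ++ rest))                      ≡⟨ cong length (filter-++ P? row rest) ⟩
  length (filter P? row ++ filter P? rest)              ≡⟨ length-++ (filter P? row) ⟩
  length (filter P? row) + length (filter P? rest)
    ≡⟨ cong₂ _+_ (trans (length-filter-map P? (f zero ,_) (tabulate g))
                        (length-filter-tabulate (P? ∘ (f zero ,_)) g))
                 (length-filter-product P? (f ∘ suc) g) ⟩
  _                                                     ∎
  where
  open ≡-Reasoning
  row  = map (f zero ,_) (tabulate g)
  rest = cartesianProduct (tabulate (f ∘ suc)) (tabulate g)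

sum≡∑ : ∀ n (f : ℕ → ℕ) → sum {n} (f ∘ toℕ) ≡ ∑ n f
sum≡∑ zero    f = refl
sum≡∑ (suc n) f = cong (_+_ (f 0)) (sum≡∑ n (f ∘ suc))

nestings≡total : ∀ {n} (σ : Permutation′ n) → nestings σ ≡ total (codeOf σ)
nestings≡total {n} σ = begin
  nestings σ                                  ≡⟨ length-filter-product (nested? σ) {n} {n} _ _ ⟩
  -- Labels belong to values: the nested arc is now indexed by its end `v` instead of its start.
  sum row                                     ≡⟨ sum-permute row (Permutation.flip σ) ⟩
  sum (row ∘ (σ ⟨$⟩ˡ_))                       ≡⟨ sum-cong-≗ column ⟩
  sum {n} (nesting n ⟪ σ ⟫ ∘ toℕ)             ≡⟨ sum≡∑ n (nesting n ⟪ σ ⟫) ⟩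
  ∑ n (nesting n ⟪ σ ⟫)                       ≡⟨ total-codeFrom n ⟪ σ ⟫ 0 n ⟨
  total (codeOf σ)                            ∎
  where
  open ≡-Reasoning
  row : Fin n → ℕ
  row i = sum (λ j → 𝟙 (nested? σ (i , j)))
  column : ∀ v → row (σ ⟨$⟩ˡ v) ≡ nesting n ⟪ σ ⟫ (toℕ v)
  column v = trans (sum-cong-≗ arc) (sum≡∑ n _)
    where
    arc : ∀ j → 𝟙 (nested? σ (σ ⟨$⟩ˡ v , j)) ≡
                𝟙 (nestedArc? (to ⟪ σ ⟫) (from ⟪ σ ⟫ (toℕ v)) (toℕ v) (toℕ j))
    arc j rewrite extend-toℕ (σ ⟨$⟩ˡ_) v | extend-toℕ (σ ⟨$⟩ʳ_) j | inverseʳ σ {v} = refl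

-- Bijectivity by counting

Seq : ℕ → Set
Seq zero    = ⊤
Seq (suc n) = Fin (suc n) × Seq n

toList : ∀ {n} → Seq n → List ℕ
toList {zero}  _       = []
toList {suc n} (p , m) = toℕ p ∷ toList m

length-toList : ∀ {n} (m : Seq n) → length (toList m) ≡ n
length-toList {zero}  _       = refl
length-toList {suc n} (_ , m) = cong suc (length-toList m)

fromBounded : ∀ n {ps} → Bounded ps → length ps ≡ n → ∃[ m ] toList {n} m ≡ ps
fromBounded zero    []       _    = tt , refl
fromBounded (suc n) (p≤ ∷ B) len with fromBounded n B (suc-injective len)
... | m , refl = (fromℕ< p< , m) , cong (_∷ _) (Fin.toℕ-fromℕ< p<)
  where p< = s≤s (≤-trans p≤ (≤-reflexive (length-toList m)))

Seq↔Fin : ∀ n → Seq n ↔ Fin (n !)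
Seq↔Fin zero    = ↔-sym Fin.1↔⊤
Seq↔Fin (suc n) = ↔-trans (↔-refl ×-↔ Seq↔Fin n) (↔-sym Fin.*↔×)

injective⇒surjective : ∀ {n} (f : Fin n → Fin n) → Injective _≡_ _≡_ f → ∀ y → ∃[ x ] f x ≡ y
injective⇒surjective {suc n} f inj y with Fin.any? (λ x → f x Fin.≟ y)
... | yes found = found
... | no  none  = contradiction (λ {x} {x′} eq → inj (Fin.punchOut-injective (≢f x) (≢f x′) eq))
                                (Fin.<⇒notInjective {f = λ x → punchOut (≢f x)} ≤-refl)
  where
  ≢f : ∀ x → y ≢ f x
  ≢f x eq = none (x , sym eq)

Seq-injective⇒surjective : ∀ {n} (f : Seq n → Seq n) → Injective _≡_ _≡_ f → ∀ y → ∃[ x ] f x ≡ y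
Seq-injective⇒surjective {n} f inj y =
  let x , eq = injective⇒surjective (to e ∘ f ∘ from e)
                 (λ eq → injective (↔-sym e) (inj (injective e eq))) (to e y)
  in from e x , injective e eq
  where
  e : Seq n ↔ Fin (n !)
  e = Seq↔Fin n
  injective : ∀ {A B : Set} (f : A ↔ B) → Injective _≡_ _≡_ (to f)
  injective f = Injection.injective (↔⇒↣ f)

-- Lehmer codes supply `n !` distinct permutations, as many as there are sequences of places.
lehmer : ∀ {n} → Seq n → Permutation′ n
lehmer {zero}  _       = Permutation.id
lehmer {suc n} (p , m) = Permutation.insert zero p (lehmer m)

lehmer-injective : ∀ {n} {m m′ : Seq n} →
                   (∀ i → lehmer m ⟨$⟩ʳ i ≡ lehmer m′ ⟨$⟩ʳ i) → m ≡ m′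
lehmer-injective {zero}  _ = refl
lehmer-injective {suc n} {p , m} {p′ , m′} eq with refl ← eq zero =
  cong (p ,_) (lehmer-injective λ i → Fin.punchIn-injective p _ _ (trans
    (sym (insert-punchIn zero p (lehmer m) i))
    (trans (eq (suc i)) (insert-punchIn zero p (lehmer m′) i))))

seqOf : ∀ {n} (σ : Permutation′ n) → ∃[ m ] build (toList {n} m) ≡ codeOf σ
seqOf {n} σ with build-surjective n (length-codeFrom n ⟪ σ ⟫ 0 n) (codeOf-history σ)
... | ps , B , len , eq with m , refl ← fromBounded n B len = m , eq

abstract

  -- From a Lehmer code to its permutation, to the history of that, to a sequence of places building
  -- this history. No stage loses information, so this is an injective self-map of a finite set and
  -- hence surjective.
  relist : ∀ {n} → Seq n → Seq n
  relist m = proj₁ (seqOf (lehmer m))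

  build-relist : ∀ {n} (m : Seq n) → build (toList (relist m)) ≡ codeOf (lehmer m)
  build-relist m = proj₂ (seqOf (lehmer m))

relist-injective : ∀ {n} → Injective _≡_ _≡_ (relist {n})
relist-injective {n} {m} {m′} eq = lehmer-injective (codeOf-injective (lehmer m) (lehmer m′)
  (trans (sym (build-relist m)) (trans (cong (build ∘ toList) eq) (build-relist m′))))

relist-surjective : ∀ {n} (m : Seq n) → ∃[ m₀ ] relist m₀ ≡ m
relist-surjective = Seq-injective⇒surjective relist relist-injective

-- Surjectivity of `relist`: each bounded sequence arises from some permutation.
build⇒code : ∀ {n ps} → Bounded ps → length ps ≡ n → Σ[ σ ∈ Permutation′ n ] codeOf σ ≡ build ps
build⇒code {n} B len with fromBounded n B len
... | m , refl with relist-surjective m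
...   | m₀ , refl = lehmer m₀ , sym (build-relist m₀)

-- Both sequences are values of `relist`, and a common word forces a common permutation, hence a
-- common Lehmer code.
build-injective : ∀ {n ps qs} → Bounded ps → Bounded qs → length ps ≡ n → length qs ≡ n →
                  build ps ≡ build qs → ps ≡ qs
build-injective {n} B B′ len len′ eq with fromBounded n B len | fromBounded n B′ len′
... | m , refl | m′ , refl with relist-surjective m | relist-surjective m′
...   | m₀ , refl | m₀′ , refl = cong (toList ∘ relist)
  (lehmer-injective (codeOf-injective (lehmer m₀) (lehmer m₀′)
    (trans (sym (build-relist m₀)) (trans eq (build-relist m₀′)))))

-- Walks

-- A walk from elevation e to elevation f above the line y = -x, together with
-- the elevations of the starting points of its east steps.
data Climb : ℕ → List Step → List ℕ → ℕ → Set where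
  []    : ∀ {e} → Climb e [] [] e
  east  : ∀ {e w es f} → Climb (suc e) w es f → Climb e (east ∷ w) (e ∷ es) f
  north : ∀ {e w es f} → Climb (suc e) w es f → Climb e (north ∷ w) es f
  south : ∀ {e w es f} → Climb e w es f → Climb (suc e) (south ∷ w) es f

-- With the first east step starting at abscissa k: all of them lie weakly below the x-axis.
data Slow : ℕ → List ℕ → Set where
  []  : ∀ {k} → Slow k []
  _∷_ : ∀ {k e es} → e ≤ k → Slow (suc k) es → Slow k (e ∷ es)

-- Elevations and coordinates

0⊖n≡-n : ∀ n → 0 ⊖ n ≡ - (+ n)
0⊖n≡-n zero    = refl
0⊖n≡-n (suc n) = refl

-- The point of abscissa `x` at elevation `e`. As the line `y = -x` falls, an east step raises the
-- elevation by one, just like a north step.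
at : ℕ → ℕ → Point
at x e = x , e ⊖ x

move-east : ∀ x e → move (at x e) east ≡ at (suc x) (suc e)
move-east x e = cong (suc x ,_) (sym (ℤ.[1+m]⊖[1+n]≡m⊖n e x))

move-north : ∀ x e → move (at x e) north ≡ at x (suc e)
move-north x e = cong (x ,_) (trans (ℤ.distribˡ-⊖-+-pos 1 e x) (cong (_⊖ x) (+-comm e 1)))

move-south : ∀ x e → move (at x (suc e)) south ≡ at x e
move-south x e = cong (x ,_) (trans (ℤ.distribˡ-⊖-+-neg 0 (suc e) x)
  (trans (cong (suc e ⊖_) (cong suc (+-identityʳ x))) (ℤ.[1+m]⊖[1+n]≡m⊖n e x)))

diagonal≡at : ∀ a → diagonal a ≡ at a 0
diagonal≡at a = cong (a ,_) (sym (0⊖n≡-n a))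

⊖-cancelʳ-≤ : ∀ k {m n} → m ⊖ k ℤ.≤ n ⊖ k → m ≤ n
⊖-cancelʳ-≤ k le = ≮⇒≥ λ lt → ℤ.≤⇒≯ le (ℤ.⊖-monoˡ-< k lt)

-a≡⊖ : ∀ a j → - (+ a) ≡ j ⊖ (a + j)
-a≡⊖ a j = trans (sym (0⊖n≡-n a)) (sym (trans (cong (j ⊖_) (+-comm a j))
  (trans (cong (_⊖ (j + a)) (sym (+-identityʳ j))) (ℤ.+-cancelˡ-⊖ j 0 a))))

below⇒≤ : ∀ a j {e} → e ⊖ (a + j) ℤ.≤ - (+ a) → e ≤ j
below⇒≤ a j {e} le = ⊖-cancelʳ-≤ (a + j) (subst (e ⊖ (a + j) ℤ.≤_) (-a≡⊖ a j) le)

≤⇒below : ∀ a j {e} → e ≤ j → e ⊖ (a + j) ℤ.≤ - (+ a)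
≤⇒below a j {e} le = subst (e ⊖ (a + j) ℤ.≤_) (sym (-a≡⊖ a j)) (ℤ.⊖-monoˡ-≤ (a + j) le)

-x≤e⊖x : ∀ x e → - (+ x) ℤ.≤ e ⊖ x
-x≤e⊖x x e = subst (ℤ._≤ e ⊖ x) (0⊖n≡-n x) (ℤ.⊖-monoˡ-≤ x (z≤n {e}))

onDiagonal⇒0 : ∀ {x e} → e ⊖ x ≡ - (+ x) → e ≡ 0
onDiagonal⇒0 {x} {e} eq =
  n≤0⇒n≡0 (⊖-cancelʳ-≤ x (ℤ.≤-reflexive (trans eq (sym (0⊖n≡-n x)))))

climb-east : ∀ {e f w es} → Climb e w es f → #[ east ] w ≡ length es
climb-east []        = refl
climb-east (east c)  = cong suc (climb-east c)
climb-east (north c) = climb-east c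
climb-east (south c) = climb-east c

climb-end : ∀ {e f w es} x → Climb e w es f → foldl move (at x e) w ≡ at (x + length es) f
climb-end {e} x [] = cong (λ x → at x e) (sym (+-identityʳ x))
climb-end {e} {f} {_ ∷ w} {_ ∷ es} x (east c) = trans (cong (λ p → foldl move p w) (move-east x e))
  (trans (climb-end (suc x) c) (cong (λ x → at x f) (sym (+-suc x (length es)))))
climb-end {e} {w = _ ∷ w} x (north c) =
  trans (cong (λ p → foldl move p w) (move-north x e)) (climb-end x c)
climb-end {suc e} {w = _ ∷ w} x (south c) =
  trans (cong (λ p → foldl move p w) (move-south x e)) (climb-end x c)

climb-++ : ∀ {e f g v w es fs} → Climb e v es f → Climb f w fs g → Climb e (v ++ w) (es ++ fs) g
climb-++ []        d = d
climb-++ (east c)  d = east (climb-++ c d)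
climb-++ (north c) d = north (climb-++ c d)
climb-++ (south c) d = south (climb-++ c d)

climb-split : ∀ {e g es} v {w} → Climb e (v ++ w) es g →
              ∃[ fs ] ∃[ gs ] ∃[ f ] es ≡ fs ++ gs × Climb e v fs f × Climb f w gs g
climb-split []          c         = [] , _ , _ , refl , [] , c
climb-split (east ∷ v)  (east c)  with climb-split v c
... | _ , _ , _ , refl , c′ , d = _ , _ , _ , refl , east c′ , d
climb-split (north ∷ v) (north c) with climb-split v c
... | _ , _ , _ , refl , c′ , d = _ , _ , _ , refl , north c′ , d
climb-split (south ∷ v) (south c) with climb-split v c
... | _ , _ , _ , refl , c′ , d = _ , _ , _ , refl , south c′ , d

-- If the east steps after the first few stay below the point reached on the
-- diagonal, then the walk does pass through that point.
climb-unsplit : ∀ {e w} fs {gs} → Slow 0 gs → Climb e w (fs ++ gs) 0 →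
                ∃[ u ] ∃[ v ] w ≡ u ++ v × Climb e u fs 0 × Climb 0 v gs 0
climb-unsplit []       s           []       = [] , [] , refl , [] , []
climb-unsplit []       (z≤n ∷ s)   (east c) = [] , _ , refl , [] , east c
climb-unsplit (_ ∷ fs) s           (east c) with climb-unsplit fs s c
... | u , v , refl , c′ , d = east ∷ u , v , refl , east c′ , d
climb-unsplit fs       s           (north c) with climb-unsplit fs s c
... | u , v , refl , c′ , d = north ∷ u , v , refl , north c′ , d
climb-unsplit fs       s           (south c) with climb-unsplit fs s c
... | u , v , refl , c′ , d = south ∷ u , v , refl , south c′ , d

EastBelow : ℕ → Point → List Step → Set
EastBelow a p w = All (ℤ._≤ - (+ a)) (eastHeights p w)

heights⇒slow : ∀ a j {e f w es} → Climb e w es f →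
               EastBelow a (at (a + j) e) w → Slow j es
heights⇒slow a j [] _ = []
heights⇒slow a j {e} (east {w = w} c) (le ∷ les) =
  below⇒≤ a j le ∷ heights⇒slow a (suc j) c
    (subst (λ p → EastBelow a p w) (trans (move-east (a + j) e)
      (cong (λ x → at x (suc e)) (sym (+-suc a j)))) les)
heights⇒slow a j {e} (north {w = w} c) les =
  heights⇒slow a j c (subst (λ p → EastBelow a p w) (move-north (a + j) e) les)
heights⇒slow a j {suc e} (south {w = w} c) les =
  heights⇒slow a j c (subst (λ p → EastBelow a p w) (move-south (a + j) e) les)

slow⇒heights : ∀ a j {e f w es} → Climb e w es f → Slow j es →
               EastBelow a (at (a + j) e) w
slow⇒heights a j [] _ = []
slow⇒heights a j {e} (east {w = w} c) (le ∷ s) =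
  ≤⇒below a j le ∷ subst (λ p → EastBelow a p w) (sym (trans (move-east (a + j) e)
      (cong (λ x → at x (suc e)) (sym (+-suc a j))))) (slow⇒heights a (suc j) c s)
slow⇒heights a j {e} (north {w = w} c) s =
  subst (λ p → EastBelow a p w) (sym (move-north (a + j) e)) (slow⇒heights a j c s)
slow⇒heights a j {suc e} (south {w = w} c) s =
  subst (λ p → EastBelow a p w) (sym (move-south (a + j) e)) (slow⇒heights a j c s)

-- The lower side of the wedge keeps elevations natural, since it excludes a south step at elevation
-- 0. The upper side bounds the elevation of an east step by its abscissa.
wedge⇒climb : ∀ x e w → All InWedge (scanl move (at x e) w) → OnDiagonal (foldl move (at x e) w) →
              ∃[ es ] Climb e w es 0 × Slow x es
wedge⇒climb x e [] _ end with refl ← onDiagonal⇒0 {x} {e} end = [] , [] , []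
wedge⇒climb x e (east ∷ w) ((_ , le) ∷ ws) end
  with wedge⇒climb (suc x) (suc e) w
         (subst (λ p → All InWedge (scanl move p w)) (move-east x e) ws)
         (subst (λ p → OnDiagonal (foldl move p w)) (move-east x e) end)
... | es , c , s = e ∷ es , east c , below⇒≤ 0 x le ∷ s
wedge⇒climb x e (north ∷ w) (_ ∷ ws) end
  with wedge⇒climb x (suc e) w
         (subst (λ p → All InWedge (scanl move p w)) (move-north x e) ws)
         (subst (λ p → OnDiagonal (foldl move p w)) (move-north x e) end)
... | es , c , s = es , north c , s
wedge⇒climb x (suc e) (south ∷ w) (_ ∷ ws) end
  with wedge⇒climb x e w
         (subst (λ p → All InWedge (scanl move p w)) (move-south x e) ws)
         (subst (λ p → OnDiagonal (foldl move p w)) (move-south x e) end)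
... | es , c , s = es , south c , s
wedge⇒climb x zero (south ∷ w) (_ ∷ (le , _) ∷ _) end =
  contradiction le (ℤ.<⇒≱ (subst (ℤ._< - (+ x)) (sym (cong (ℤ._- 1ℤ) (0⊖n≡-n x)))
    (subst (- (+ x) ℤ.- 1ℤ ℤ.<_) (ℤ.+-identityʳ (- (+ x))) (ℤ.+-monoʳ-< (- (+ x)) ℤ.-<+))))

-- The walk with given elevations

vertical : ℕ → ℕ → List Step
vertical e f = replicate (f ∸ e) north ++ replicate (e ∸ f) south

data Direction : ℕ → ℕ → Set where
  up   : ∀ k {e} → Direction e (k + e)
  down : ∀ k {e} → Direction (suc k + e) e

direction : ∀ e f → Direction e f
direction zero    f       = subst (Direction 0) (+-identityʳ f) (up f)
direction (suc e) zero    = subst (λ e → Direction (suc e) 0) (+-identityʳ e) (down e)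
direction (suc e) (suc f) with direction e f
... | up k   = subst (Direction (suc e)) (+-suc k e) (up k)
... | down k = subst (λ e → Direction (suc e) (suc f)) (+-suc k f) (down k)

vertical-up : ∀ k e → vertical e (k + e) ≡ replicate k north
vertical-up k e rewrite m+n∸n≡m k e | m≤n⇒m∸n≡0 (m≤n+m e k) = ++-identityʳ _

vertical-down : ∀ k e → vertical (k + e) e ≡ replicate k south
vertical-down k e rewrite m+n∸n≡m k e | m≤n⇒m∸n≡0 (m≤n+m e k) = refl

-- The default 0 makes the final vertical run descend to the diagonal.
next : List ℕ → ℕ
next []       = 0
next (e ∷ es) = e

walk : ℕ → List ℕ → List Step
turns : List ℕ → List Step
walk e es      = vertical e (next es) ++ turns es
turns []       = []
turns (e ∷ es) = east ∷ walk (suc e) es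

PartiallyDirected : List Step → Set
PartiallyDirected = Linked (λ s t → ¬ Opposite s t)

north-vertical : ∀ e f {w} → PartiallyDirected (north ∷ vertical (suc e) f ++ w) →
                 north ∷ vertical (suc e) f ≡ vertical e f
north-vertical e f l with direction (suc e) f
... | up k rewrite vertical-up k (suc e) | +-suc k e = sym (vertical-up (suc k) e)
... | down k rewrite vertical-down (suc k) f with ¬o ∷ _ ← l = contradiction north-south ¬o

south-vertical : ∀ e f {w} → PartiallyDirected (south ∷ vertical e f ++ w) →
                 south ∷ vertical e f ≡ vertical (suc e) f
south-vertical e f l with direction e f
... | up zero rewrite vertical-up 0 e = sym (vertical-down 1 e)
... | up (suc k) rewrite vertical-up (suc k) e with ¬o ∷ _ ← l = contradiction south-north ¬o
... | down k = trans (cong (south ∷_) (vertical-down (suc k) f)) (sym (vertical-down (suc (suc k)) f))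

-- Without immediate reversals each vertical run is the monotone one between its two elevations, so
-- the elevations determine the walk.
climb⇒walk : ∀ {e w es} → Climb e w es 0 → PartiallyDirected w → w ≡ walk e es
climb⇒walk [] _ = refl
climb⇒walk (east {e} {es = es} c) l = trans (cong (east ∷_) (climb⇒walk c (Linked.tail l)))
  (cong (_++ turns (e ∷ es)) (sym (vertical-up 0 e)))
climb⇒walk (north {e} {es = es} c) l with refl ← climb⇒walk c (Linked.tail l) =
  cong (_++ turns es) (north-vertical e (next es) l)
climb⇒walk (south {e} {es = es} c) l with refl ← climb⇒walk c (Linked.tail l) =
  cong (_++ turns es) (south-vertical e (next es) l)

climb-norths : ∀ k {e f w es} → Climb (k + e) w es f → Climb e (replicate k north ++ w) es f
climb-norths zero    c = c
climb-norths (suc k) {e} {f} {w} {es} c = north (climb-norths k (subst (λ e → Climb e w es f) (sym (+-suc k e)) c))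

climb-souths : ∀ k {e f w es} → Climb e w es f → Climb (k + e) (replicate k south ++ w) es f
climb-souths zero    c = c
climb-souths (suc k) c = south (climb-souths k c)

climb-vertical : ∀ e f {g w es} → Climb f w es g → Climb e (vertical e f ++ w) es g
climb-vertical e f c with direction e f
... | up k   rewrite vertical-up k e         = climb-norths k c
... | down k rewrite vertical-down (suc k) f = climb-souths (suc k) c

walk-climbs : ∀ e es → Climb e (walk e es) es 0
walk-climbs e []       = climb-vertical e 0 []
walk-climbs e (f ∷ es) = climb-vertical e f (east (walk-climbs (suc f) es))

wedge-norths : ∀ x k e {w} → k + e ≤ x → All InWedge (scanl move (at x (k + e)) w) →
               All InWedge (scanl move (at x e) (replicate k north ++ w))
wedge-norths x zero    e     le ws = ws
wedge-norths x (suc k) e {w} le ws = (-x≤e⊖x x e , ≤⇒below 0 x (≤-trans (m≤n+m e (suc k)) le)) ∷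
  subst (λ p → All InWedge (scanl move p (replicate k north ++ w))) (sym (move-north x e))
    (wedge-norths x k (suc e) (subst (_≤ x) (sym (+-suc k e)) le)
      (subst (λ e → All InWedge (scanl move (at x e) w)) (sym (+-suc k e)) ws))

wedge-souths : ∀ x k e {w} → k + e ≤ x → All InWedge (scanl move (at x e) w) →
               All InWedge (scanl move (at x (k + e)) (replicate k south ++ w))
wedge-souths x zero    e     le ws = ws
wedge-souths x (suc k) e {w} le ws = (-x≤e⊖x x (suc k + e) , ≤⇒below 0 x le) ∷
  subst (λ p → All InWedge (scanl move p (replicate k south ++ w))) (sym (move-south x (k + e)))
    (wedge-souths x k e (<⇒≤ le) ws)

wedge-vertical : ∀ x e f {w} → e ≤ x → f ≤ x → All InWedge (scanl move (at x f) w) →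
                 All InWedge (scanl move (at x e) (vertical e f ++ w))
wedge-vertical x e f e≤x f≤x ws with direction e f
... | up k   rewrite vertical-up k e         = wedge-norths x k e f≤x ws
... | down k rewrite vertical-down (suc k) f = wedge-souths x (suc k) f e≤x ws

walk-wedge : ∀ x e es → e ≤ x → Slow x es → All InWedge (scanl move (at x e) (walk e es))
walk-wedge x e []       e≤x _         = wedge-vertical x e 0 e≤x z≤n ((-x≤e⊖x x 0 , ≤⇒below 0 x z≤n) ∷ [])
walk-wedge x e (f ∷ es) e≤x (f≤x ∷ s) = wedge-vertical x e f e≤x f≤x
  ((-x≤e⊖x x f , ≤⇒below 0 x f≤x) ∷
   subst (λ p → All InWedge (scanl move p (walk (suc f) es))) (sym (move-east x f))
     (walk-wedge (suc x) (suc f) es (s≤s f≤x) s))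

directed-replicate : ∀ k s es → PartiallyDirected (turns es) →
                     PartiallyDirected (replicate k s ++ turns es)
directed-replicate zero          s     es       l = l
directed-replicate (suc zero)    s     []       l = [-]
directed-replicate (suc zero)    s     (_ ∷ es) l = (λ ()) ∷ l
directed-replicate (suc (suc k)) north es       l = (λ ()) ∷ directed-replicate (suc k) north es l
directed-replicate (suc (suc k)) south es       l = (λ ()) ∷ directed-replicate (suc k) south es l
directed-replicate (suc (suc k)) east  es       l = (λ ()) ∷ directed-replicate (suc k) east es l

directed-east : ∀ {w} → PartiallyDirected w → PartiallyDirected (east ∷ w)
directed-east []      = [-]
directed-east [-]     = (λ ()) ∷ [-]
directed-east (o ∷ l) = (λ ()) ∷ o ∷ l

walk-directed : ∀ e es → PartiallyDirected (walk e es)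
turns-directed : ∀ es → PartiallyDirected (turns es)
walk-directed e es with next es | direction e (next es)
... | _ | up k   rewrite vertical-up k e = directed-replicate k north es (turns-directed es)
... | f | down k rewrite vertical-down (suc k) f =
  directed-replicate (suc k) south es (turns-directed es)
turns-directed []       = []
turns-directed (e ∷ es) = directed-east (walk-directed (suc e) es)

walk-PDSAW : ∀ {n es} → Slow 0 es → length es ≡ n → PDSAW n
walk-PDSAW {es = es} s len = record
  { steps             = walk 0 es
  ; partiallyDirected = walk-directed 0 es
  ; staysInWedge      = walk-wedge 0 0 es z≤n s
  ; endsOnDiagonal    = subst OnDiagonal (sym (climb-end 0 c)) (0⊖n≡-n (length es))
  ; eastSteps         = trans (climb-east c) len
  }
  where c = walk-climbs 0 es

PDSAW-climb : ∀ {n} (P : PDSAW n) → ∃[ es ] Climb 0 (steps P) es 0 × Slow 0 es × length es ≡ n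
PDSAW-climb P with wedge⇒climb 0 0 (steps P) (PDSAW.staysInWedge P) (PDSAW.endsOnDiagonal P)
... | es , c , s = es , c , s , trans (sym (climb-east c)) (PDSAW.eastSteps P)

-- North steps and last descent

climbs : ℕ → List ℕ → ℕ
climbs e []       = 0
-- The east step itself raises the elevation from `f` to `suc f`.
climbs e (f ∷ es) = (f ∸ e) + climbs (suc f) es

#-++ : ∀ s v w → #[ s ] (v ++ w) ≡ #[ s ] v + #[ s ] w
#-++ s v w = trans (cong length (filter-++ (s ≟_) v w)) (length-++ (filter (s ≟_) v))

norths-replicate-north : ∀ k → #[ north ] (replicate k north) ≡ k
norths-replicate-north zero    = refl
norths-replicate-north (suc k) = cong suc (norths-replicate-north k)

norths-replicate-south : ∀ k → #[ north ] (replicate k south) ≡ 0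
norths-replicate-south zero    = refl
norths-replicate-south (suc k) = norths-replicate-south k

norths-vertical : ∀ e f → #[ north ] (vertical e f) ≡ f ∸ e
norths-vertical e f = trans (#-++ north (replicate (f ∸ e) north) _)
  (trans (cong₂ _+_ (norths-replicate-north (f ∸ e)) (norths-replicate-south (e ∸ f))) (+-identityʳ _))

norths-walk : ∀ e es → #[ north ] (walk e es) ≡ climbs e es
norths-walk e [] = trans (#-++ north (vertical e 0) [])
  (trans (+-identityʳ _) (trans (norths-vertical e 0) (0∸n≡0 e)))
norths-walk e (f ∷ es) = trans (#-++ north (vertical e f) _)
  (cong₂ _+_ (norths-vertical e f) (norths-walk (suc f) es))

jumps-ʳ++ : ∀ p ps es → jumps (es ʳ++ p ∷ ps) ≡ jumps (p ∷ ps) + climbs (suc p) es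
jumps-ʳ++ p ps []       = sym (+-identityʳ _)
jumps-ʳ++ p ps (f ∷ es) = trans (jumps-ʳ++ f (p ∷ ps) es) (+-assoc (jumps (p ∷ ps)) _ _)

souths-replicate : ∀ k d → foldl southsSinceEast d (replicate k south) ≡ k + d
souths-replicate zero    d = refl
souths-replicate (suc k) d = trans (souths-replicate k (suc d)) (+-suc k d)

lastDescent-walk : ∀ es p ps {q qs} → es ʳ++ p ∷ ps ≡ q ∷ qs →
                   foldl southsSinceEast 0 (walk (suc p) es) ≡ suc q
lastDescent-walk [] p ps refl =
  trans (foldl-++ southsSinceEast 0 (replicate (suc p) south) [])
    (trans (souths-replicate (suc p) 0) (+-identityʳ (suc p)))
lastDescent-walk (f ∷ es) p ps eq =
  -- Whatever was counted on the vertical run, the east step at the head of `turns (f ∷ es)` resets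
  -- it to 0.
  trans (foldl-++ southsSinceEast 0 (vertical (suc p) f) (turns (f ∷ es)))
    (lastDescent-walk es f (p ∷ ps) eq)

-- The number of earlier east steps is at once the abscissa in `Slow` and the length in `Bounded`.
Bounded-ʳ++ : ∀ {es ps} → Slow (length ps) es → Bounded ps → Bounded (es ʳ++ ps)
Bounded-ʳ++ []       B = B
Bounded-ʳ++ (le ∷ s) B = Bounded-ʳ++ s (le ∷ B)

Bounded-ʳ++⁻ : ∀ es {ps} → Bounded (es ʳ++ ps) → Slow (length ps) es × Bounded ps
Bounded-ʳ++⁻ []       B = [] , B
Bounded-ʳ++⁻ (e ∷ es) B with Bounded-ʳ++⁻ es B
... | s , le ∷ B′ = le ∷ s , B′

-- The bijection and its factors

++-split : ∀ {A : Set} (xs xs′ : List A) {ys ys′} → length xs ≡ length xs′ →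
           xs ++ ys ≡ xs′ ++ ys′ → xs ≡ xs′ × ys ≡ ys′
++-split []       []         _   eq = refl , eq
++-split (x ∷ xs) (x′ ∷ xs′) len eq with refl , eq′ ← ∷-injective eq
  with refl , eq″ ← ++-split xs xs′ (suc-injective len) eq′ = refl , eq″

++-suffix : ∀ {A : Set} (xs xs′ : List A) {ys ys′} → length ys ≤ length ys′ →
            xs ++ ys ≡ xs′ ++ ys′ → ∃[ zs ] zs ++ ys ≡ ys′ × xs ≡ xs′ ++ zs
++-suffix xs       []         _  eq = xs , eq , refl
++-suffix []  (x′ ∷ xs′) {ys} {ys′} le refl = contradiction le (<⇒≱ (s≤s
  (≤-trans (m≤n+m (length ys′) (length xs′)) (≤-reflexive (sym (length-++ xs′))))))
++-suffix (x ∷ xs) (x′ ∷ xs′) le eq with refl , eq′ ← ∷-injective eq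
  with zs , eq₁ , refl ← ++-suffix xs xs′ le eq′ = zs , eq₁ , refl

Bounded-++ : ∀ {ps qs} → Bounded ps → Bounded qs → Bounded (ps ++ qs)
Bounded-++                []        B = B
Bounded-++ {_ ∷ ps} {qs} (p≤ ∷ B′) B =
  ≤-trans p≤ (≤-trans (m≤m+n _ _) (≤-reflexive (sym (length-++ ps)))) ∷ Bounded-++ B′ B

-- By counting, the word is the code of some permutation, and codes are histories.
build-history : ∀ {ps} → Bounded ps → History 0 (build ps) 0
build-history B with build⇒code B refl
... | σ , eq = subst (λ w → History 0 w 0) eq (codeOf-history σ)

climb-functional : ∀ {e w es es′ f f′} → Climb e w es f → Climb e w es′ f′ → es ≡ es′
climb-functional []        []        = refl
climb-functional (east c)  (east d)  = cong (_ ∷_) (climb-functional c d)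
climb-functional (north c) (north d) = climb-functional c d
climb-functional (south c) (south d) = climb-functional c d

Bounded-reverse : ∀ {es} → Slow 0 es → Bounded (reverse es)
Bounded-reverse s = Bounded-ʳ++ s []

Slow-reverse : ∀ {ps} → Bounded ps → Slow 0 (reverse ps)
Slow-reverse {ps} B =
  proj₁ (Bounded-ʳ++⁻ (reverse ps) (subst Bounded (sym (reverse-involutive ps)) B))

codeFrom-cong : ∀ {s t} → (∀ x → to s x ≡ to t x) → ∀ n x m → codeFrom n s x m ≡ codeFrom n t x m
codeFrom-cong eq n x zero    = refl
codeFrom-cong {s} {t} eq n x (suc m) = cong₂ _∷_ letter-cong (codeFrom-cong eq n (suc x) m)
  where
  from-eq : from s x ≡ from t x
  from-eq = trans (sym (strictlyInverseʳ t (from s x)))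
    (cong (from t) (trans (sym (eq (from s x))) (strictlyInverseˡ s x)))
  letter-cong : letter n s x ≡ letter n t x
  letter-cong rewrite from-eq | eq x = cong ⟨ _ , _ ,_⟩ (∑-cong n λ {j} _ →
    cong (λ v → 𝟙 (j <? from t x ×-dec from t x ≤? x ×-dec x <? v
                   ⊎-dec from t x <? j ×-dec x <? from t x ×-dec v <? x)) (eq j))

codeOf-cong : ∀ {n} {σ τ : Permutation′ n} → (∀ i → σ ⟨$⟩ʳ i ≡ τ ⟨$⟩ʳ i) → codeOf σ ≡ codeOf τ
codeOf-cong {n} {σ} {τ} eq = codeFrom-cong ext n 0 n
  where
  ext : ∀ x → to ⟪ σ ⟫ x ≡ to ⟪ τ ⟫ x
  ext x with view n x
  ... | inside i    = trans (extend-toℕ _ i) (trans (cong toℕ (eq i)) (sym (extend-toℕ _ i)))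
  ... | outside n≤x = trans (extend-≥ _ n≤x) (sym (extend-≥ _ n≤x))

module _ {n} (P : PDSAW n) where

  abstract

    elevations : List ℕ
    elevations = proj₁ (PDSAW-climb P)

    steps-climb : Climb 0 (steps P) elevations 0
    steps-climb = proj₁ (proj₂ (PDSAW-climb P))

    elevations-slow : Slow 0 elevations
    elevations-slow = proj₁ (proj₂ (proj₂ (PDSAW-climb P)))

    length-elevations : length elevations ≡ n
    length-elevations = proj₂ (proj₂ (proj₂ (PDSAW-climb P)))

  steps≡walk : steps P ≡ walk 0 elevations
  steps≡walk = climb⇒walk steps-climb (PDSAW.partiallyDirected P)

  positions : List ℕ
  positions = reverse elevations

  positions-bounded : Bounded positions
  positions-bounded = Bounded-reverse elevations-slow

  length-positions : length positions ≡ n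
  length-positions = trans (length-reverse elevations) length-elevations

  abstract

    permutationOf : Permutation′ n
    permutationOf = proj₁ (build⇒code positions-bounded length-positions)

    codeOf-permutationOf : codeOf permutationOf ≡ build positions
    codeOf-permutationOf = proj₂ (build⇒code positions-bounded length-positions)

positions-unique : ∀ {n} (P : PDSAW n) {es f} → Climb 0 (steps P) es f → positions P ≡ reverse es
positions-unique P c = cong reverse (climb-functional (steps-climb P) c)

permutationOf-injective : ∀ {n} (P Q : PDSAW n) →
  (∀ i → permutationOf P ⟨$⟩ʳ i ≡ permutationOf Q ⟨$⟩ʳ i) → steps P ≡ steps Q
permutationOf-injective P Q eq =
  trans (steps≡walk P) (trans (cong (walk 0) elevations≡) (sym (steps≡walk Q)))
  where
  code≡ : codeOf (permutationOf P) ≡ codeOf (permutationOf Q)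
  code≡ = codeOf-cong {σ = permutationOf P} {permutationOf Q} eq
  elevations≡ : elevations P ≡ elevations Q
  elevations≡ = reverse-injective {x = elevations P} {elevations Q}
    (build-injective (positions-bounded P) (positions-bounded Q) (length-positions P) (length-positions Q)
      (trans (sym (codeOf-permutationOf P)) (trans code≡ (codeOf-permutationOf Q))))

permutationOf-unique : ∀ {n} (P : PDSAW n) {es f} (σ : Permutation′ n) → Climb 0 (steps P) es f →
  codeOf σ ≡ build (reverse es) → ∀ i → permutationOf P ⟨$⟩ʳ i ≡ σ ⟨$⟩ʳ i
permutationOf-unique P σ c eq = codeOf-injective (permutationOf P) σ
  (trans (codeOf-permutationOf P) (trans (cong build (positions-unique P c)) (sym eq)))

-- The quantification over `Q` is what surjectivity means for walks that count as equal when their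
-- steps are.
permutationOf-surjective : ∀ {n} (σ : Permutation′ n) → Σ[ P ∈ PDSAW n ]
  ∀ {Q : PDSAW n} → steps Q ≡ steps P → ∀ i → permutationOf Q ⟨$⟩ʳ i ≡ σ ⟨$⟩ʳ i
permutationOf-surjective {n} σ
  with build-surjective n (length-codeFrom n ⟪ σ ⟫ 0 n) (codeOf-history σ)
... | ps , B , len , eq = walk-PDSAW (Slow-reverse B) (trans (length-reverse ps) len) ,
  λ {Q} steps≡ → permutationOf-unique Q σ
    (subst (λ w → Climb 0 w (reverse ps) 0) (sym steps≡) (walk-climbs 0 (reverse ps)))
    (trans (sym eq) (cong build (sym (reverse-involutive ps))))

Ψ : ∀ m → Bijection (PDSAWs (suc m)) (Permutations (suc m))
Ψ m = record
  { to        = permutationOf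
  ; cong      = λ {P} {Q} eq → permutationOf-unique P (permutationOf Q)
                  (subst (λ w → Climb 0 w (elevations Q) 0) (sym eq) (steps-climb Q))
                  (codeOf-permutationOf Q)
  ; bijective = (λ {P} {Q} → permutationOf-injective P Q)
              , λ σ → proj₁ (permutationOf-surjective σ)
                    , λ {Q} → proj₂ (permutationOf-surjective σ) {Q}
  }

northSteps≡nestings : ∀ {n} (P : PDSAW n) → northSteps P ≡ nestings (permutationOf P)
northSteps≡nestings P = begin
  northSteps P                       ≡⟨ cong #[ north ] (steps≡walk P) ⟩
  #[ north ] (walk 0 (elevations P)) ≡⟨ norths-walk 0 (elevations P) ⟩
  climbs 0 (elevations P)            ≡⟨ climbs≡jumps (elevations-slow P) ⟩
  jumps (positions P)                ≡⟨ total-build (positions-bounded P) ⟨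
  total (build (positions P))        ≡⟨ cong total (codeOf-permutationOf P) ⟨
  total (codeOf (permutationOf P))   ≡⟨ nestings≡total (permutationOf P) ⟨
  nestings (permutationOf P)         ∎
  where
  open ≡-Reasoning
  climbs≡jumps : ∀ {es} → Slow 0 es → climbs 0 es ≡ jumps (reverse es)
  climbs≡jumps []                 = refl
  climbs≡jumps {_ ∷ es} (z≤n ∷ _) = sym (jumps-ʳ++ 0 [] es)

lastDescent≡firstValue : ∀ {m} (P : PDSAW (suc m)) → lastDescent P ≡ firstValue (permutationOf P)
lastDescent≡firstValue P = begin
  lastDescent P
    ≡⟨ cong (foldl southsSinceEast 0) (steps≡walk P) ⟩
  foldl southsSinceEast 0 (walk 0 (elevations P))
    ≡⟨ descent (elevations-slow P) (length-elevations P) ⟩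
  suc (firstZero (build (positions P)))
    ≡⟨ cong (suc ∘ firstZero) (codeOf-permutationOf P) ⟨
  suc (firstZero (codeOf (permutationOf P)))
    ≡⟨ cong suc (firstZero-codeOf (permutationOf P)) ⟩
  firstValue (permutationOf P) ∎
  where
  open ≡-Reasoning
  descent : ∀ {es m} → Slow 0 es → length es ≡ suc m →
            foldl southsSinceEast 0 (walk 0 es) ≡ suc (firstZero (build (reverse es)))
  -- Since the first elevation is 0, the walk begins with its first east step. The length rules out
  -- an empty reversed list.
  descent {e ∷ es} s@(z≤n ∷ _) len
    with reverse (0 ∷ es) in eq | Bounded-reverse s | trans (length-reverse (0 ∷ es)) len
  ... | q ∷ qs | q≤ ∷ B | _ =
    trans (lastDescent-walk es 0 [] eq) (cong suc (sym (firstZero-insert (≤-build q≤ B))))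

-- Cuts of a permutation, bounded prefixes and factors

module _ {n} (σ : Permutation′ n) where

  -- A bounded prefix builds a history of its own, so after its letters the path of `σ` is back at
  -- height 0.
  prefix-cut : ∀ {qs ps} → Bounded qs → length qs + length ps ≡ n → codeOf σ ≡ build (qs ++ ps) →
               Cut ⟪ σ ⟫ (length qs) × codeFrom n ⟪ σ ⟫ (length qs) (length ps) ≡ build ps
  prefix-cut {qs} {ps} B refl eq = ups⇒cut (m≤m+n k _) (History-functional
    (subst₂ (λ h w → History h w (ups k)) ups-zero (proj₁ halves) (history 0 k (m≤m+n k _)))
    (build-history B)) , proj₂ halves
    where
    open Encode n ⟪ σ ⟫ (Cut-⟪⟫ σ)
    k = length qs
    halves : codeFrom n ⟪ σ ⟫ 0 k ≡ build qs × codeFrom n ⟪ σ ⟫ k (length ps) ≡ build ps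
    halves = ++-split (codeFrom n ⟪ σ ⟫ 0 k) (build qs)
      (trans (length-codeFrom n ⟪ σ ⟫ 0 k) (sym (length-build B)))
      (trans (sym (codeFrom-++ n ⟪ σ ⟫ 0 k (length ps))) (trans eq (build-++ ps B)))

  -- At a cut the code falls into two histories, each built by a bounded sequence. By injectivity of
  -- `build`, these two sequences together are `ps`.
  cut-prefix : ∀ k {m ps} → k + m ≡ n → Cut ⟪ σ ⟫ k → Bounded ps → length ps ≡ n →
               codeOf σ ≡ build ps → ∃[ qs ] ∃[ rs ] ps ≡ qs ++ rs × length qs ≡ k × Bounded qs
  cut-prefix k {m} {ps} refl c B len eq
    with build-surjective k (length-codeFrom n ⟪ σ ⟫ 0 k)
           (subst₂ (λ h h′ → History h (codeFrom n ⟪ σ ⟫ 0 k) h′) ups-zero (cut⇒ups c)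
             (history 0 k (m≤m+n k m)))
       | build-surjective m (length-codeFrom n ⟪ σ ⟫ k m)
           (subst₂ (λ h h′ → History h (codeFrom n ⟪ σ ⟫ k m) h′) (cut⇒ups c) (cut⇒ups (Cut-⟪⟫ σ))
             (history k m ≤-refl))
    where open Encode n ⟪ σ ⟫ (Cut-⟪⟫ σ)
  ... | qs , Bq , lenq , eqq | rs , Br , lenr , eqr = qs , rs ,
    build-injective B (Bounded-++ Bq Br) len
      (trans (length-++ qs) (cong₂ _+_ lenq lenr))
      (trans (sym eq) (trans (codeFrom-++ n ⟪ σ ⟫ 0 k m)
        (trans (sym (cong₂ _++_ eqq eqr)) (sym (build-++ rs Bq))))) ,
    lenq , Bq

  to-⟪⟫ : ∀ i → to ⟪ σ ⟫ (toℕ i) ≡ toℕ (σ ⟨$⟩ʳ i)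
  to-⟪⟫ = extend-toℕ (σ ⟨$⟩ʳ_)

  cuts⇒factor : ∀ {a b} → a Fin.≤ b → Cut ⟪ σ ⟫ (toℕ a) → Cut ⟪ σ ⟫ (suc (toℕ b)) → PermFactor σ a b
  cuts⇒factor {a} {b} a≤b ca cb = record
    { a≤b    = a≤b
    ; within = λ i a≤i i≤b → subst (toℕ a ≤_) (to-⟪⟫ i) (to-≥ ca a≤i) ,
                             ≤-pred (subst (_< suc (toℕ b)) (to-⟪⟫ i) (to-< cb (s≤s i≤b)))
    ; below  = λ i i<a → subst (_< toℕ a) (to-⟪⟫ i) (to-< ca i<a)
    ; above  = λ i b<i → subst (toℕ b <_) (to-⟪⟫ i) (to-≥ cb b<i)
    }

  cut : ∀ {k} → k ≤ n → (∀ i → toℕ i < k → toℕ (σ ⟨$⟩ʳ i) < k) →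
        (∀ i → k ≤ toℕ i → k ≤ toℕ (σ ⟨$⟩ʳ i)) → Cut ⟪ σ ⟫ k
  cut {k} k≤n lower upper = record
    { to-<   = λ {x} → to< x
    ; from-< = λ {x} x<k → ≰⇒> λ k≤ → <⇒≱ x<k
        (subst (k ≤_) (strictlyInverseˡ ⟪ σ ⟫ x) (to≥ (from ⟪ σ ⟫ x) k≤))
    }
    where
    to< : ∀ x → x < k → to ⟪ σ ⟫ x < k
    to< x x<k with view n x
    ... | inside i    = subst (_< k) (sym (to-⟪⟫ i)) (lower i x<k)
    ... | outside n≤x = contradiction (<-≤-trans x<k k≤n) (≤⇒≯ n≤x)
    to≥ : ∀ x → k ≤ x → k ≤ to ⟪ σ ⟫ x
    to≥ x k≤x with view n x
    ... | inside i    = subst (k ≤_) (sym (to-⟪⟫ i)) (upper i k≤x)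
    ... | outside n≤x = subst (k ≤_) (sym (extend-≥ _ n≤x)) k≤x

  module _ {a b} (F : PermFactor σ a b) where

    open PermFactor F

    factor⇒cutˡ : Cut ⟪ σ ⟫ (toℕ a)
    factor⇒cutˡ = cut (<⇒≤ (Fin.toℕ<n a)) below λ i a≤i → case i a≤i (toℕ i ≤? toℕ b)
      where
      case : ∀ i → toℕ a ≤ toℕ i → _ → toℕ a ≤ toℕ (σ ⟨$⟩ʳ i)
      case i a≤i (yes i≤b) = proj₁ (within i a≤i i≤b)
      case i a≤i (no  i≰b) = ≤-trans a≤b (<⇒≤ (above i (≰⇒> i≰b)))

    factor⇒cutʳ : Cut ⟪ σ ⟫ (suc (toℕ b))
    factor⇒cutʳ = cut (Fin.toℕ<n b) (λ i i<b → case i (≤-pred i<b) (toℕ a ≤? toℕ i)) above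
      where
      case : ∀ i → toℕ i ≤ toℕ b → _ → toℕ (σ ⟨$⟩ʳ i) < suc (toℕ b)
      case i i≤b (yes a≤i) = s≤s (proj₂ (within i a≤i i≤b))
      case i i≤b (no  a≰i) = ≤-trans (below i (≰⇒> a≰i)) (≤-trans a≤b (n≤1+n _))

-- Factors of walks in terms of elevations

diagonal-below⇒slow : ∀ a {w es f} → Climb 0 w es f → EastBelow a (diagonal a) w → Slow 0 es
diagonal-below⇒slow a {w} c = heights⇒slow a 0 c ∘ subst (λ p → EastBelow a p w)
  (trans (diagonal≡at a) (cong (λ x → at x 0) (sym (+-identityʳ a))))

slow⇒diagonal-below : ∀ a {w es f} → Climb 0 w es f → Slow 0 es → EastBelow a (diagonal a) w
slow⇒diagonal-below a {w} c = subst (λ p → EastBelow a p w)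
  (sym (trans (diagonal≡at a) (cong (λ x → at x 0) (sym (+-identityʳ a))))) ∘ slow⇒heights a 0 c

climb-diagonal : ∀ {w es f a} → Climb 0 w es f → end w ≡ diagonal a → length es ≡ a × f ≡ 0
climb-diagonal {es = es} c eq with refl , eq₂ ← ,-injective (trans (sym (climb-end 0 c)) eq) =
  refl , onDiagonal⇒0 eq₂

-- `slow₂₃` and `slow₃` translate `belowStart` and `belowEnd`; the three climbs start and end at
-- elevation 0 because the factor has its ends on the diagonal.
record Split (w : List Step) (a b : ℕ) (f : List Step) (es : List ℕ) : Set where
  field
    before after : List Step
    es₁ es₂ es₃  : List ℕ
    subPath      : w ≡ before ++ f ++ after
    joined       : es ≡ es₁ ++ es₂ ++ es₃
    length₁      : length es₁ ≡ a
    length₂      : a + length es₂ ≡ b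
    climb₁       : Climb 0 before es₁ 0
    climb₂       : Climb 0 f es₂ 0
    climb₃       : Climb 0 after es₃ 0
    slow₂₃       : Slow 0 (es₂ ++ es₃)
    slow₃        : Slow 0 es₃

split : ∀ {w a b f es} → Climb 0 w es 0 → WalkFactor w a b f → Split w a b f es
split {f = f} {es} c F
  with climb-split (WalkFactor.before F) (subst (λ w → Climb 0 w es 0) (WalkFactor.subPath F) c)
... | es₁ , es₂₃ , _ , refl , c₁ , c₂₃ with refl , refl ← climb-diagonal c₁ (WalkFactor.starts F)
  with climb-split f c₂₃
... | es₂ , es₃ , _ , refl , c₂ , c₃
  with len , refl ← climb-diagonal (climb-++ c₁ c₂) (WalkFactor.ends F) = record
  { subPath = WalkFactor.subPath F
  ; joined  = refl
  ; length₁ = refl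
  ; length₂ = trans (sym (length-++ es₁)) len
  ; climb₁  = c₁
  ; climb₂  = c₂
  ; climb₃  = c₃
  ; slow₂₃  = diagonal-below⇒slow _ (climb-++ c₂ c₃) (WalkFactor.belowStart F)
  ; slow₃   = diagonal-below⇒slow _ c₃ (WalkFactor.belowEnd F)
  }

-- As `gs` is slow, the walk meets the diagonal after the east steps of `fs`, by `climb-unsplit`,
-- and a factor can end there. With `fs` shorter than `es₂` this refutes primality.
subfactor : ∀ {w a b f es} (S : Split w a b f es) → let open Split S in
            ∀ {fs gs} → es₂ ++ es₃ ≡ fs ++ gs → 0 < length fs → Slow 0 gs →
            ∃[ f′ ] WalkFactor w a (a + length fs) f′
subfactor {w} {a} {f = f} S {fs} {gs} eq 0<fs s
  with u , v , eq′ , c , d ← climb-unsplit fs s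
         (subst (λ es → Climb 0 _ es 0) eq (climb-++ (Split.climb₂ S) (Split.climb₃ S))) = u , record
  { before     = before
  ; after      = v
  ; subPath    = trans subPath (cong (before ++_) eq′)
  ; starts     = trans (climb-end 0 climb₁) (trans (sym (diagonal≡at (length es₁))) (cong diagonal length₁))
  ; ends       = trans (climb-end 0 (climb-++ climb₁ c)) (trans (sym (diagonal≡at _))
                   (cong diagonal (trans (length-++ es₁) (cong (_+ length fs) length₁))))
  ; a<b        = m<m+n a 0<fs
  ; belowStart = slow⇒diagonal-below a (climb-++ c d) (subst (Slow 0) eq slow₂₃)
  ; belowEnd   = slow⇒diagonal-below (a + length fs) d s
  }
  where open Split S

-- The image of a prime factor

module _ {n} (P : PDSAW n) {a m} (Q : PDSAW (suc m))
         (F : PrimeWalkFactor (steps P) a (a + suc m) (steps Q)) where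

  private
    σ = permutationOf P
    τ = permutationOf Q
    s = ⟪ σ ⟫

    S : Split (steps P) a (a + suc m) (steps Q) (elevations P)
    S = split (steps-climb P) (proj₁ F)

    open Split S

    ps₁ ps₂ ps₃ : List ℕ
    ps₁ = reverse es₁
    ps₂ = reverse es₂
    ps₃ = reverse es₃

    -- The factor starts at place `p` of the permutation because `p` east steps of the walk come
    -- after it.
    p : ℕ
    p = length ps₃

    elevations≡ : elevations Q ≡ es₂
    elevations≡ = climb-functional (steps-climb Q) climb₂

    bounded₂ : Bounded ps₂
    bounded₂ = subst (Bounded ∘ reverse) elevations≡ (positions-bounded Q)

    bounded₃ : Bounded ps₃
    bounded₃ = Bounded-reverse slow₃

    len₂ : length ps₂ ≡ suc m
    len₂ = trans (length-reverse es₂) (+-cancelˡ-≡ a _ _ length₂)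

    len₁ : length ps₁ ≡ a
    len₁ = trans (length-reverse es₁) length₁

    positions≡ : positions P ≡ ps₃ ++ ps₂ ++ ps₁
    positions≡ = begin
      reverse (elevations P)              ≡⟨ cong reverse joined ⟩
      reverse (es₁ ++ es₂ ++ es₃)         ≡⟨ reverse-++ es₁ (es₂ ++ es₃) ⟩
      reverse (es₂ ++ es₃) ++ ps₁         ≡⟨ cong (_++ ps₁) (reverse-++ es₂ es₃) ⟩
      (ps₃ ++ ps₂) ++ ps₁                 ≡⟨ ++-assoc ps₃ ps₂ ps₁ ⟩
      ps₃ ++ ps₂ ++ ps₁                   ∎
      where open ≡-Reasoning

    code≡ : codeOf σ ≡ build (ps₃ ++ ps₂ ++ ps₁)
    code≡ = trans (codeOf-permutationOf P) (cong build positions≡)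

    len₃₂₁ : p + length (ps₂ ++ ps₁) ≡ n
    len₃₂₁ = trans (sym (length-++ ps₃)) (trans (cong length (sym positions≡)) (length-positions P))

    size : p + (suc m + a) ≡ n
    size = trans (cong (_+_ p) (sym (trans (length-++ ps₂) (cong₂ _+_ len₂ len₁)))) len₃₂₁

    cut-p : Cut s p
    cut-p = proj₁ (prefix-cut σ bounded₃ len₃₂₁ code≡)

    len₃₂ : length (ps₃ ++ ps₂) ≡ p + suc m
    len₃₂ = trans (length-++ ps₃) (cong (_+_ p) len₂)

    cut-p+m : Cut s (p + suc m)
    cut-p+m = subst (Cut s) len₃₂ (proj₁ (prefix-cut σ {ps₃ ++ ps₂} {ps₁} (Bounded-++ bounded₃ bounded₂)
      (trans (cong₂ _+_ len₃₂ len₁) (trans (+-assoc p (suc m) a) size))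
      (trans code≡ (cong build (sym (++-assoc ps₃ ps₂ ps₁))))))

    code₂ : codeFrom n s p (suc m) ≡ codeOf τ
    code₂ = begin
      codeFrom n s p (suc m) ≡⟨ proj₁ (++-split (codeFrom n s p (suc m)) (build ps₂)
          (trans (length-codeFrom n s p (suc m)) (sym (trans (length-build bounded₂) len₂)))
          (begin
            codeFrom n s p (suc m) ++ codeFrom n s (p + suc m) a ≡⟨ codeFrom-++ n s p (suc m) a ⟨
            codeFrom n s p (suc m + a)
              ≡⟨ cong (codeFrom n s p) (trans (length-++ ps₂) (cong₂ _+_ len₂ len₁)) ⟨
            codeFrom n s p (length (ps₂ ++ ps₁)) ≡⟨ proj₂ (prefix-cut σ bounded₃ len₃₂₁ code≡) ⟩
            build (ps₂ ++ ps₁) ≡⟨ build-++ ps₁ bounded₂ ⟩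
            build ps₂ ++ build ps₁ ∎)) ⟩
      build ps₂              ≡⟨ cong (build ∘ reverse) elevations≡ ⟨
      build (positions Q)    ≡⟨ codeOf-permutationOf Q ⟨
      codeOf τ               ∎
      where open ≡-Reasoning

  factor-position : ℕ
  factor-position = p

  factor-size : p + (a + suc m) ≡ n
  factor-size = trans (cong (_+_ p) (+-comm a (suc m))) size

  factor-restricts : ∀ i → toℕ i ≡ p → RestrictsTo σ i τ
  factor-restricts i i≡p j j′ eq = begin
    toℕ (σ ⟨$⟩ʳ j)              ≡⟨ to-⟪⟫ σ j ⟨
    to s (toℕ j)                ≡⟨ cong (to s) (trans eq (cong (_+ toℕ j′) i≡p)) ⟩
    to s (p + toℕ j′)           ≡⟨ code-injective p (suc m) a cut-p cut-p+m (Cut-⟪⟫ τ)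
                                     (subst (λ n → codeFrom n s p (suc m) ≡ codeOf τ) (sym size) code₂)
                                     (Fin.toℕ<n j′) ⟩
    p + to ⟪ τ ⟫ (toℕ j′)       ≡⟨ cong₂ _+_ (sym i≡p) (to-⟪⟫ τ j′) ⟩
    toℕ i + toℕ (τ ⟨$⟩ʳ j′)     ∎
    where open ≡-Reasoning

  private
    -- By `cut-prefix`, a cut inside the block yields a bounded prefix of `positions P`, that is, a
    -- slow suffix of the elevations. The walk then has a factor that starts with `Q` but ends
    -- earlier.
    no-cut : ∀ {c} → p < c → c < p + suc m → ¬ Cut s c
    no-cut {c} p<c c<p+m cut-c = found (cut-prefix σ c (m+[n∸m]≡n c≤n) cut-c (positions-bounded P)
                                         (length-positions P) (codeOf-permutationOf P))
      where
      c≤n : c ≤ n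
      c≤n = ≤-trans (<⇒≤ c<p+m) (≤-trans (m≤m+n (p + suc m) a)
        (≤-reflexive (trans (+-assoc p (suc m) a) size)))
      len₂₃ : length (es₂ ++ es₃) ≡ suc m + p
      len₂₃ = trans (length-++ es₂)
        (cong₂ _+_ (trans (sym (length-reverse es₂)) len₂) (sym (length-reverse es₃)))
      found : ¬ (∃[ qs ] ∃[ rs ] positions P ≡ qs ++ rs × length qs ≡ c × Bounded qs)
      found (qs , rs , eq , len , B) with ++-suffix (reverse rs) es₁ {reverse qs} {es₂ ++ es₃} c≤ joined′
        where
        c≤ : length (reverse qs) ≤ length (es₂ ++ es₃)
        c≤ = subst₂ _≤_ (sym (trans (length-reverse qs) len)) (trans (+-comm p (suc m)) (sym len₂₃))
               (<⇒≤ c<p+m)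
        joined′ : reverse rs ++ reverse qs ≡ es₁ ++ es₂ ++ es₃
        joined′ = trans (sym (reverse-++ qs rs)) (trans (cong reverse (sym eq))
          (trans (reverse-involutive (elevations P)) joined))
      -- `zs` holds the elevations from abscissa `a` up to the slow suffix; it is non-empty as
      -- `c < p + suc m` and shorter than `es₂` as `p < c`.
      ... | zs , zs++ , _ = proj₂ F (a , a + length zs , f′ , proj₂ sub , ≤-refl , <⇒≤ short , inj₂ short)
        where
        sum≡ : length zs + c ≡ suc m + p
        sum≡ = trans (cong (_+_ (length zs)) (sym (trans (length-reverse qs) len)))
          (trans (sym (length-++ zs)) (trans (cong length zs++) len₂₃))
        0<zs : 0 < length zs
        0<zs = +-cancelʳ-< c 0 (length zs) (subst (c <_) (trans (+-comm p (suc m)) (sym sum≡)) c<p+m)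
        short : a + length zs < a + suc m
        short = +-monoʳ-< a (+-cancelʳ-< p _ _
          (<-≤-trans (+-monoʳ-< (length zs) p<c) (≤-reflexive sum≡)))
        sub = subfactor S (sym zs++) 0<zs (Slow-reverse B)
        f′  = proj₁ sub

  factor-prime : ∀ i j → toℕ i ≡ p → toℕ j ≡ p + m → PrimePermFactor σ i j
  factor-prime i j i≡p j≡p+m =
    cuts⇒factor σ (≤-trans (≤-reflexive i≡p) (≤-trans (m≤m+n p m) (≤-reflexive (sym j≡p+m))))
      (subst (Cut s) (sym i≡p) cut-p)
      (subst (Cut s) (trans (+-suc p m) (cong suc (sym j≡p+m))) cut-p+m) ,
    λ (i′ , j′ , F′ , within) → smaller i′ j′ F′ within
    where
    j<p+m : suc (toℕ j) ≤ p + suc m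
    j<p+m = ≤-reflexive (trans (cong suc j≡p+m) (sym (+-suc p m)))
    smaller : ∀ i′ j′ → PermFactor σ i′ j′ → ¬ StrictlyWithin (toℕ i′) (toℕ j′) (toℕ i) (toℕ j)
    smaller i′ j′ F′ (i≤i′ , j′≤j , inj₁ i<i′) = no-cut (subst (_< toℕ i′) i≡p i<i′)
      (<-≤-trans (s≤s (≤-trans (PermFactor.a≤b F′) j′≤j)) j<p+m) (factor⇒cutˡ σ F′)
    smaller i′ j′ F′ (i≤i′ , j′≤j , inj₂ j′<j) = no-cut
      (s≤s (≤-trans (≤-reflexive (sym i≡p)) (≤-trans i≤i′ (PermFactor.a≤b F′))))
      (<-≤-trans (s≤s j′<j) j<p+m) (factor⇒cutʳ σ F′)

-- The sequence of prime factors

image : PDSAW⁺ → Permutation⁺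
image (k , Q) = k , permutationOf Q

-- The walk is read from left to right while the factors of the permutation accumulate from right to
-- left. By `p + a ≡ n`, the `p` places still to be covered correspond to the east steps from
-- abscissa `a` on.
walkPrimes⇒permPrimes : ∀ {n} (P : PDSAW n) {a Qs} → WalkPrimesFrom P a Qs →
  ∀ p {τs} → p + a ≡ n → PermPrimesFrom (permutationOf P) p τs →
  PermPrimesFrom (permutationOf P) 0 (map image Qs ʳ++ τs)
walkPrimes⇒permPrimes {n} P [] p eq acc
  with refl ← +-cancelʳ-≡ n p 0 eq = acc
walkPrimes⇒permPrimes {n} P (_∷_ {a} {m} {Q} F Fs) p {τs} eq acc =
  walkPrimes⇒permPrimes P Fs q (factor-size P Q F)
    (cons (fromℕ< q<n) (fromℕ< q+m<n) (Fin.toℕ-fromℕ< q<n) (Fin.toℕ-fromℕ< q+m<n)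
      (factor-prime P Q F _ _ (Fin.toℕ-fromℕ< q<n) (Fin.toℕ-fromℕ< q+m<n))
      (factor-restricts P Q F _ (Fin.toℕ-fromℕ< q<n))
      (subst (λ p → PermPrimesFrom (permutationOf P) p τs) p≡ acc))
  where
  q = factor-position P Q F
  size : q + suc m + a ≡ n
  size = trans (+-assoc q (suc m) a) (trans (cong (_+_ q) (+-comm (suc m) a)) (factor-size P Q F))
  p≡ : p ≡ q + suc m
  p≡ = +-cancelʳ-≡ a p (q + suc m) (trans eq (sym size))
  q+m<n : q + m < n
  q+m<n = ≤-trans (≤-reflexive (sym (+-suc q m))) (≤-trans (m≤m+n (q + suc m) a) (≤-reflexive size))
  q<n : q < n
  q<n = ≤-<-trans (m≤m+n q m) q+m<n

theorem1p5 : Σ[ Ψ ∈ (∀ m → Bijection (PDSAWs (suc m)) (Permutations (suc m))) ]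
    (∀ m (P : PDSAW (suc m)) (N M : ℤ) →
    (+ northSteps P ≡ N × + lastDescent P ≡ M)
    ⇔ (+ nestings (Bijection.to (Ψ m) P) ≡ N
    × + firstValue (Bijection.to (Ψ m) P) ≡ M))
    × (∀ m (P : PDSAW (suc m)) (Ps : List PDSAW⁺) →
    WalkPrimes P Ps →
    PermPrimes (Bijection.to (Ψ m) P)
    (reverse (map (λ (k , Q) → k , Bijection.to (Ψ k) Q) Ps)))
-- At abscissa 0 nothing is covered yet, so the empty accumulator stands at the right end, place
-- `suc m`.
theorem1p5 = Ψ , statistics , λ m P Ps Fs →
  walkPrimes⇒permPrimes P Fs (suc m) (+-identityʳ (suc m)) []
  where
  statistics : ∀ m (P : PDSAW (suc m)) (N M : ℤ) →
               (+ northSteps P ≡ N × + lastDescent P ≡ M) ⇔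
               (+ nestings (permutationOf P) ≡ N × + firstValue (permutationOf P) ≡ M)
  statistics m P N M = mk⇔
    (λ (eq₁ , eq₂) → trans (cong +_ (sym norths≡)) eq₁ , trans (cong +_ (sym descent≡)) eq₂)
    (λ (eq₁ , eq₂) → trans (cong +_ norths≡) eq₁ , trans (cong +_ descent≡) eq₂)
    where
    norths≡  = northSteps≡nestings P
    descent≡ = lastDescent≡firstValue P
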